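{- There is an algorithm that, given a pushdown automaton $\mathcal{M}=(Q,\Gamma,\mathcal{A},\Delta)$ (with no $\varepsilon$-rules) and a configuration $p_0\alpha_0$ with $p_0\in Q$ and $\alpha_0\in\Gamma^*$, decides whether $p_0\alpha_0$ is regular, i.e. whether there is a state $f$ of some finite labelled transition system such that $p_0\alpha_0\sim f$.
   Context: A labelled transition system (LTS) is $\mathcal{L}=(\mathcal{S},\mathcal{A},(\xrightarrow{a})_{a\in\mathcal{A}})$ with states $\mathcal{S}$, actions $\mathcal{A}$ and transition relations $\xrightarrow{a}\subseteq\mathcal{S}\times\mathcal{S}$; it is finite if $\mathcal{S}$ and $\mathcal{A}$ are finite. A relation $\mathcal{B}\subseteq\mathcal{S}\times\mathcal{S}$ is a bisimulation if for every $(s,t)\in\mathcal{B}$: each $s\xrightarrow{a}s'$ is matched by some $t\xrightarrow{a}t'$ with $(s',t')\in\mathcal{B}$, and each $t\xrightarrow{a}t'$ is matched by some $s\xrightarrow{a}s'$ with $(s',t')\in\mathcal{B}$; $s\sim t$ (bisimilar) if some bisimulation contains $(s,t)$. States of different LTSs are compared in their disjoint union. A pushdown automaton (pda) is $\mathcal{M}=(Q,\Gamma,\mathcal{A},\Delta)$ with finite nonempty sets of control states $Q$, stack symbols $\Gamma$, actions $\mathcal{A}$, and rules $\Delta$, each rule of the form $pX\xrightarrow{a}q\alpha$ with $p,q\in Q$, $X\in\Gamma$, $a\in\mathcal{A}$, $\alpha\in\Gamma^*$ (there are no $\varepsilon$-rules). It generates the LTS whose states (configurations) are pairs $p\sigma$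 with $p\in Q$ and $\sigma$ either a finite word in $\Gamma^*$ or an infinite word $\alpha\beta^\omega$ with $\alpha\in\Gamma^*$, $\beta\in\Gamma^+$, and with transitions $pX\sigma\xrightarrow{a}q\alpha\sigma$ whenever $pX\xrightarrow{a}q\alpha$ is in $\Delta$. -}

module Defs where

open import Data.Nat using (ℕ; suc; _≤_)
open import Data.Fin using (Fin)
open import Data.Bool using (Bool; true)
open import Data.Empty using (⊥)
open import Data.List using (List; []; _∷_; _++_)
open import Data.List.NonEmpty using (List⁺; _∷_)
open import Data.List.Membership.Propositional using (_∈_)
open import Data.Product using (Σ; _×_; _,_)
open import Data.Sum using (_⊎_; inj₁; inj₂)
open import Relation.Binary.PropositionalEquality using (_≡_)

record LTS (A : Set) : Set₁ where
  field
    State : Set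
    step  : State → A → State → Set
open LTS public

IsBisimulation : {A : Set} (L : LTS A) → (State L → State L → Set) → Set
IsBisimulation L B =
  ∀ s t → B s t →
    (∀ a s' → step L s a s' → Σ (State L) λ t' → step L t a t' × B s' t')
  × (∀ a t' → step L t a t' → Σ (State L) λ s' → step L s a s' × B s' t')

Bisimilar : {A : Set} (L : LTS A) → State L → State L → Set₁
Bisimilar L s t = Σ (State L → State L → Set) λ B → IsBisimulation L B × B s t

-- Disjoint union of two LTSs (states of different LTSs are compared here).
UnionStep : {A : Set} (L₁ L₂ : LTS A) →
            State L₁ ⊎ State L₂ → A → State L₁ ⊎ State L₂ → Set
UnionStep L₁ L₂ (inj₁ s) a (inj₁ s') = step L₁ s a s'
UnionStep L₁ L₂ (inj₂ s) a (inj₂ s') = step L₂ s a s'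
UnionStep L₁ L₂ _ _ _ = ⊥

_⊎ᴸ_ : {A : Set} → LTS A → LTS A → LTS A
L₁ ⊎ᴸ L₂ = record { State = State L₁ ⊎ State L₂ ; step = UnionStep L₁ L₂ }

FiniteLTS : (nA : ℕ) → Set
FiniteLTS nA = Σ ℕ λ n → (Fin n → Fin nA → Fin n → Bool)

finiteLTS : {nA : ℕ} → FiniteLTS nA → LTS (Fin nA)
finiteLTS (n , δ) = record { State = Fin n ; step = λ s a s' → δ s a s' ≡ true }

record Rule (nQ nΓ nA : ℕ) : Set where
  constructor rule
  field
    src : Fin nQ
    top : Fin nΓ
    act : Fin nA
    tgt : Fin nQ
    push : List (Fin nΓ)

record PDA : Set where
  field
    nQ nΓ nA : ℕ
    Q-nonempty : 1 ≤ nQ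
    Γ-nonempty : 1 ≤ nΓ
    A-nonempty : 1 ≤ nA
    Δ : List (Rule nQ nΓ nA)
open PDA public

-- Stack contents: a finite word σ ∈ Γ*, or an infinite word αβ^ω
-- represented by the pair (α , β) with β ∈ Γ⁺.
data Stack (nΓ : ℕ) : Set where
  fin : List (Fin nΓ) → Stack nΓ
  inf : List (Fin nΓ) → List⁺ (Fin nΓ) → Stack nΓ

_++ˢ_ : {nΓ : ℕ} → List (Fin nΓ) → Stack nΓ → Stack nΓ
α ++ˢ fin σ   = fin (α ++ σ)
α ++ˢ inf γ β = inf (α ++ γ) β

data Pop {nΓ : ℕ} : Stack nΓ → Fin nΓ → Stack nΓ → Set where
  pop-fin  : ∀ {X σ} → Pop (fin (X ∷ σ)) X (fin σ)
  pop-infα : ∀ {X α β} → Pop (inf (X ∷ α) β) X (inf α β)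
  pop-infβ : ∀ {X β} → Pop (inf [] (X ∷ β)) X (inf β (X ∷ β))

Config : PDA → Set
Config M = Fin (nQ M) × Stack (nΓ M)

data PStep (M : PDA) : Config M → Fin (nA M) → Config M → Set where
  pstep : ∀ {p X a q α s σ} →
          rule p X a q α ∈ Δ M →
          Pop s X σ →
          PStep M (p , s) a (q , α ++ˢ σ)


PDA-LTS : (M : PDA) → LTS (Fin (nA M))
PDA-LTS M = record { State = Config M ; step = PStep M }

Regular : (M : PDA) → Fin (nQ M) → List (Fin (nΓ M)) → Set₁
Regular M p₀ α₀ =
  Σ (FiniteLTS (nA M)) λ F → Σ (Fin (proj₁ F)) λ f →
    Bisimilar (PDA-LTS M ⊎ᴸ finiteLTS F) (inj₁ (p₀ , fin α₀)) (inj₂ f)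
  where open import Data.Product using (proj₁)

{-# OPTIONS --safe #-}

-- Write s ~[ k ] t for k-step bisimilarity and ≈ for its intersection over all k.  Replacing
-- the tails below a nonempty stack prefix turns k-step agreement into (k + 1)-step agreement,
-- so pumping a prefix t is a contraction; since a regular configuration reaches only finitely
-- many classes, if all the (r , tⁿσ) are reachable then tⁿσ is eventually constant in n, equal
-- to a limit.  The heart of the proof is that the index from which it is constant is bounded
-- in terms of t alone.  Let b be such an index.  A run popping copies of t from tᵇσ is matched
-- by a run from the limit; looking at the moment when a stack suffix of the latter run was
-- uncovered, one finds that each (r , tⁿσ) is equivalent to (p , B ρ) with B short and every
-- (r′ , ρ) equivalent to a short head on top of some tᵉσ with e > n.  If two exponents n < m
-- give the same short data, then k-step agreement of tⁿσ with the limit yields (k + 1)-step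
-- agreement, so tⁿσ is already the limit; by pigeonhole a large b can be lowered.
--
-- Popping from the limit now shows that a tail σ below which t can be pumped is described,
-- up to ≈, by boundedly many short heads on the limit.  A tall reachable configuration has
-- many such tails, two of them coincide, and the part in between can be cut out.  Hence in the
-- regular case every reachable configuration has a representative of computably bounded
-- height, and regularity amounts to the existence of a finite certificate of bounded size.
module Submission where

open import Defs
open import Data.Bool using (Bool; true; false)
import Data.Bool.Properties as Boolₚ
open import Data.Empty using (⊥; ⊥-elim)
open import Data.Fin as Fin using (Fin; toℕ)
import Data.Fin.Properties as Finₚ
open import Data.List
  using (List; []; _∷_; _++_; length; map; filter; lookup; take; drop; allFin; cartesianProduct; cartesianProductWith)
import Data.List.Properties as Listₚ
open import Data.List.Properties
  using ( length-filter; ∷-injective; length-++; ++-assoc; ++-identityʳ; ++-cancelʳ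
        ; take++drop≡id; length-take; length-++-≤ʳ)
open import Data.List.Membership.Propositional using (_∈_; find; lose)
open import Data.List.Membership.Propositional.Properties
  using (∈-++⁺ˡ; ∈-++⁺ʳ; ∈-map⁺; ∈-cartesianProductWith⁺; ∈-allFin; ∈-cartesianProduct⁺)
import Data.List.Membership.DecPropositional as DecMembership
open import Data.List.Relation.Unary.All as All using (All; all?)
open import Data.List.Relation.Unary.Any as Any using (Any; here; there; any?)
open import Data.List.Relation.Unary.Any.Properties using (lookup-index)
open import Data.Nat
  using (ℕ; zero; suc; pred; _+_; _*_; _∸_; _⊔_; _≤_; _<_; z≤n; s≤s; _<?_; _≤?_; _≤′_; ≤′-refl; ≤′-step)
open import Data.Nat.Induction using (<-rec)
open import Data.Nat.ListAction using (sum)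
open import Data.Nat.Properties
open import Data.Product using (Σ; ∃; ∃₂; _×_; _,_; proj₁; proj₂)
import Data.Product.Properties as Productₚ
open import Data.Sum using (_⊎_; inj₁; inj₂)
open import Data.Unit using (⊤; tt)
open import Data.Vec as Vec using (Vec; []; _∷_)
import Data.Vec.Properties as Vecₚ
open import Function using (_∘_)
open import Relation.Binary.Definitions using (DecidableEquality)
open import Relation.Binary.PropositionalEquality
open import Relation.Nullary using (Dec; yes; no; ¬_; ¬?; does; contradiction)
open import Relation.Nullary.Decidable using (_×-dec_; _→-dec_; map′; decidable-stable)

-- Finite enumerations

-- Comparing positions in `xs` rather than values avoids an equality test on `A`.
pigeonhole-∈ : {A : Set} (xs : List A) {n : ℕ} → length xs < n →
               (f : Fin n → A) → (∀ i → f i ∈ xs) →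
               ∃₂ λ i j → i Fin.< j × f i ≡ f j
pigeonhole-∈ xs lt f f∈ with Finₚ.pigeonhole lt (Any.index ∘ f∈)
... | i , j , i<j , eq =
  i , j , i<j , trans (lookup-index (f∈ i)) (trans (cong (lookup xs) eq) (sym (lookup-index (f∈ j))))

vecsOver : {A : Set} → List A → (n : ℕ) → List (Vec A n)
vecsOver xs zero    = [] ∷ []
vecsOver xs (suc n) = cartesianProductWith _∷_ xs (vecsOver xs n)

∈-vecsOver : {A : Set} {xs : List A} {n : ℕ} (v : Vec A n) →
             (∀ i → Vec.lookup v i ∈ xs) → v ∈ vecsOver xs n
∈-vecsOver []      h = here refl
∈-vecsOver (x ∷ v) h =
  ∈-cartesianProductWith⁺ _∷_ (h Fin.zero) (∈-vecsOver v (h ∘ Fin.suc))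

wordsUpTo : {A : Set} → List A → ℕ → List (List A)
wordsUpTo xs zero    = [] ∷ []
wordsUpTo xs (suc n) = [] ∷ cartesianProductWith _∷_ xs (wordsUpTo xs n)

∈-wordsUpTo : {A : Set} {xs : List A} → (∀ x → x ∈ xs) →
              ∀ n w → length w ≤ n → w ∈ wordsUpTo xs n
∈-wordsUpTo h zero    []      le       = here refl
∈-wordsUpTo h (suc n) []      le       = here refl
∈-wordsUpTo h (suc n) (x ∷ w) (s≤s le) =
  there (∈-cartesianProductWith⁺ _∷_ (h x) (∈-wordsUpTo h n w le))

sublists : {A : Set} → List A → List (List A)
sublists []       = [] ∷ []
sublists (x ∷ xs) = sublists xs ++ map (x ∷_) (sublists xs)

-- `P` will speak of `≈`, for which no decision is at hand; the selected sublist still serves to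
-- prove decidable goals. Being one of `sublists xs`, it ranges over finitely many candidates.
¬¬-comprehension : {A : Set} (P : A → Set) (xs : List A) →
  ¬ ¬ (Σ (List A) λ ys → ys ∈ sublists xs × (∀ {x} → x ∈ ys → P x)
                       × (∀ {x} → x ∈ xs → P x → x ∈ ys))
¬¬-comprehension P [] k = k ([] , here refl , (λ ()) , λ ())
¬¬-comprehension P (x ∷ xs) k =
  ¬¬-comprehension P xs λ (ys , ys∈ , sound , complete) →
    (λ ¬Px → k (ys , ∈-++⁺ˡ ys∈ , sound ,
       λ { (here refl) Px → contradiction Px ¬Px
         ; (there x∈) Px → complete x∈ Px }))
    λ Px → k (x ∷ ys , ∈-++⁺ʳ (sublists xs) (∈-map⁺ (x ∷_) ys∈) ,
       (λ { (here refl) → Px ; (there x∈) → sound x∈ }) ,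
       λ { (here refl) _ → here refl ; (there x∈) Px → there (complete x∈ Px) })

¬¬-Fin : (n : ℕ) {P : Fin n → Set} → (∀ i → ¬ ¬ P i) → ¬ ¬ (∀ i → P i)
¬¬-Fin zero    h k = k λ ()
¬¬-Fin (suc n) h k = h Fin.zero λ p₀ → ¬¬-Fin n (h ∘ Fin.suc) λ p →
  k λ { Fin.zero → p₀ ; (Fin.suc i) → p i }

Fin-bounded : (n : ℕ) (f : Fin n → ℕ) → ∃ λ m → ∀ i → f i ≤ m
Fin-bounded zero    f = 0 , λ ()
Fin-bounded (suc n) f with Fin-bounded n (f ∘ Fin.suc)
... | m , h = f Fin.zero ⊔ m ,
  λ { Fin.zero → m≤m⊔n _ m ; (Fin.suc i) → ≤-trans (h i) (m≤n⊔m (f Fin.zero) m) }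

module _ {A : Set} {P P′ : A → Set} (P? : ∀ x → Dec (P x)) (P′? : ∀ x → Dec (P′ x))
         (P⊆P′ : ∀ {x} → P x → P′ x) where

  length-filter-mono : ∀ xs → length (filter P? xs) ≤ length (filter P′? xs)
  length-filter-mono [] = z≤n
  length-filter-mono (x ∷ xs) with P? x | P′? x
  ... | yes p | yes _ = s≤s (length-filter-mono xs)
  ... | yes p | no ¬p = contradiction (P⊆P′ p) ¬p
  ... | no  _ | yes _ = m≤n⇒m≤1+n (length-filter-mono xs)
  ... | no  _ | no  _ = length-filter-mono xs

  length-filter-mono-< : ∀ {x xs} → x ∈ xs → P′ x → ¬ P x →
                         length (filter P? xs) < length (filter P′? xs)
  length-filter-mono-< {x} {_ ∷ xs} (here refl) p′ ¬p with P? x | P′? x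
  ... | yes p | _      = contradiction p ¬p
  ... | no _  | yes _  = s≤s (length-filter-mono xs)
  ... | no _  | no ¬p′ = contradiction p′ ¬p′
  length-filter-mono-< {xs = y ∷ xs} (there x∈) p′ ¬p with P? y | P′? y
  ... | yes p | yes _ = s≤s (length-filter-mono-< x∈ p′ ¬p)
  ... | yes p | no ¬q = contradiction (P⊆P′ p) ¬q
  ... | no  _ | yes _ = m≤n⇒m≤1+n (length-filter-mono-< x∈ p′ ¬p)
  ... | no  _ | no  _ = length-filter-mono-< x∈ p′ ¬p

-- Whenever some element of `xs` is new, the number of elements satisfying `P k` grows strictly; it
-- never exceeds `length xs`.
ascending-chain-stabilises :
  {A : Set} (P : ℕ → A → Set) → (∀ k x → Dec (P k x)) →
  (∀ k {x} → P k x → P (suc k) x) → (xs : List A) →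
  ∃ λ k → ∀ {x} → x ∈ xs → P (suc k) x → P k x
ascending-chain-stabilises P P? mono xs = go (length xs) 0 (m≤n+m _ _)
  where
  size : ℕ → ℕ
  size k = length (filter (P? k) xs)
  go : ∀ n k → length xs ≤ size k + n → ∃ λ k → ∀ {x} → x ∈ xs → P (suc k) x → P k x
  go n k le with any? (λ x → P? (suc k) x ×-dec ¬? (P? k x)) xs
  ... | no none = k , λ {x} x∈ p → decidable-stable (P? k x) λ ¬p →
          none (lose x∈ (p , ¬p))
  ... | yes new with find new
  ...   | x , x∈ , p , ¬p with n | length-filter-mono-< (P? k) (P? (suc k)) (mono k) x∈ p ¬p
  ...     | zero  | lt = contradiction
              (≤-trans lt (length-filter (P? (suc k)) xs))
              (≤⇒≯ (≤-trans le (≤-reflexive (+-identityʳ _))))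
  ...     | suc n | lt = go n (suc k)
              (≤-trans le (≤-trans (≤-reflexive (+-suc _ n)) (+-monoˡ-≤ n lt)))

++-split : {A : Set} (as : List A) {bs cs ds : List A} → as ++ bs ≡ cs ++ ds →
           (∃ λ es → cs ≡ as ++ es × bs ≡ es ++ ds) ⊎
           (∃ λ es → as ≡ cs ++ es × ds ≡ es ++ bs)
++-split []       {cs = cs}     eq = inj₁ (cs , refl , eq)
++-split (a ∷ as) {cs = []}     eq = inj₂ (a ∷ as , refl , sym eq)
++-split (a ∷ as) {cs = c ∷ cs} eq with ∷-injective eq
... | refl , eq′ with ++-split as eq′
...   | inj₁ (es , p , q) = inj₁ (es , cong (a ∷_) p , q)
...   | inj₂ (es , p , q) = inj₂ (es , cong (a ∷_) p , q)

tabulate-choice : {A : Set} {n : ℕ} {P : Fin n → A → Set} → (∀ i → ∃ (P i)) →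
                  ∃ λ (v : Vec A n) → ∀ i → P i (Vec.lookup v i)
tabulate-choice {P = P} h =
  Vec.tabulate (proj₁ ∘ h) ,
  λ i → subst (P i) (sym (Vecₚ.lookup∘tabulate (proj₁ ∘ h) i)) (proj₂ (h i))

-- Each of `suc (length xs)` disjoint windows of width `w` contributes one labelled index, so a
-- repeated label comes with two distinct indices.
label-recurs : {A : Set} (xs : List A) (w : ℕ) (P : ℕ → A → Set) →
  (∀ i → i ≤ length xs → ∃ λ x → x ∈ xs × ∃ λ n → i * w ≤ n × n < suc i * w × P n x) →
  ∃ λ x → ∃₂ λ n m → n < m × m < suc (length xs) * w × P n x × P m x
label-recurs xs w P at = from-repeat (pigeonhole-∈ xs ≤-refl (λ i → proj₁ (at′ i)) (λ i → proj₁ (proj₂ (at′ i))))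
  where
  at′ = λ (i : Fin (suc (length xs))) → at (toℕ i) (Finₚ.toℕ≤pred[n] i)
  from-repeat : (∃₂ λ i j → i Fin.< j × proj₁ (at′ i) ≡ proj₁ (at′ j)) →
                ∃ λ x → ∃₂ λ n m → n < m × m < suc (length xs) * w × P n x × P m x
  from-repeat (i , j , i<j , eq) with at′ i | at′ j
  from-repeat (i , j , i<j , refl) | x , _ , n , _ , n< , pₙ | _ , _ , m , m≥ , m< , pₘ =
    x , n , m , ≤-trans n< (≤-trans (*-monoˡ-≤ w i<j) m≥) ,
    ≤-trans m< (*-monoˡ-≤ w (Finₚ.toℕ<n j)) , pₙ , pₘ

-- Configurations with finite stacks

module FiniteStacks (M : PDA) where

  Q Γ Act Conf : Set
  Q    = Fin (nQ M)
  Γ    = Fin (nΓ M)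
  Act  = Fin (nA M)
  Conf = Q × List Γ

  Step : Conf → Act → Conf → Set
  Step (p , [])    a c = ⊥
  Step (p , X ∷ σ) a c = Σ Q λ q → Σ (List Γ) λ α → rule p X a q α ∈ Δ M × c ≡ (q , α ++ σ)

  infixr 5 _◅_ _◅◅_
  data Run : Conf → List Act → Conf → Set where
    ε   : ∀ {s} → Run s [] s
    _◅_ : ∀ {s s′ u a w} → Step s a s′ → Run s′ w u → Run s (a ∷ w) u

  _◅◅_ : ∀ {s t u v w} → Run s v t → Run t w u → Run s (v ++ w) u
  ε       ◅◅ ρ = ρ
  (x ◅ π) ◅◅ ρ = x ◅ (π ◅◅ ρ)

  -- The sum is a crude bound for the longest pushed word; the successor keeps it nonzero, so that
  -- it can be cancelled from products.
  maxPush : ℕ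
  maxPush = suc (sum (map (λ ρ → length (Rule.push ρ)) (Δ M)))

  push≤maxPush : ∀ {p X a q α} → rule p X a q α ∈ Δ M → length α ≤ maxPush
  push≤maxPush r∈ = m≤n⇒m≤1+n (go (Δ M) r∈)
    where
    go : ∀ rs {p X a q α} → rule p X a q α ∈ rs →
         length α ≤ sum (map (λ ρ → length (Rule.push ρ)) rs)
    go (r ∷ rs) (here refl) = m≤m+n _ _
    go (r ∷ rs) (there r∈)  = ≤-trans (go rs r∈) (m≤n+m _ (length (Rule.push r)))

  step-++ : ∀ {p γ a q γ′} σ → Step (p , γ) a (q , γ′) → Step (p , γ ++ σ) a (q , γ′ ++ σ)
  step-++ {γ = X ∷ γ} σ (q , α , r∈ , refl) = q , α , r∈ , cong (q ,_) (++-assoc α γ σ)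

  run-++ : ∀ {p γ w q γ′} σ → Run (p , γ) w (q , γ′) → Run (p , γ ++ σ) w (q , γ′ ++ σ)
  run-++ σ ε       = ε
  run-++ σ (x ◅ π) = step-++ σ x ◅ run-++ σ π

  step-length : ∀ {p γ a q γ′} → Step (p , γ) a (q , γ′) → length γ′ ≤ length γ + maxPush
  step-length {γ = X ∷ γ} (q , α , r∈ , refl) =
    ≤-trans (≤-reflexive (trans (length-++ α) (+-comm (length α) _)))
            (+-mono-≤ (n≤1+n _) (push≤maxPush r∈))

  run-length : ∀ {p γ w q γ′} → Run (p , γ) w (q , γ′) →
               length γ′ ≤ length γ + length w * maxPush
  run-length ε = ≤-reflexive (sym (+-identityʳ _))
  run-length {γ = γ} {w = a ∷ w} (x ◅ π) = ≤-trans (run-length π)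
    (≤-trans (+-monoˡ-≤ _ (step-length x)) (≤-reflexive (+-assoc (length γ) maxPush _)))

  -- A step removes at most one symbol, so a run no longer than `γ` cannot act on what lies beneath
  -- it.
  run-untouched : ∀ {p w c} γ {σ} → length w ≤ length γ → Run (p , γ ++ σ) w c →
                  ∃₂ λ q γ′ → Run (p , γ) w (q , γ′) × c ≡ (q , γ′ ++ σ)
  run-untouched γ le ε = _ , γ , ε , refl
  run-untouched (X ∷ γ) {σ} (s≤s le) ((q , α , r∈ , refl) ◅ π)
    with run-untouched (α ++ γ) {σ}
           (≤-trans le (≤-trans (m≤n+m _ (length α)) (≤-reflexive (sym (length-++ α)))))
           (subst (λ τ → Run (q , τ) _ _) (sym (++-assoc α γ σ)) π)
  ... | q′ , γ′ , π′ , eq = q′ , γ′ , (q , α , r∈ , refl) ◅ π′ , eq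

  -- Approximants of bisimilarity and their decidability

  infix 4 _~[_]_ _≈_
  _~[_]_ : Conf → ℕ → Conf → Set
  s ~[ zero  ] t = ⊤
  s ~[ suc k ] t =
      (∀ {a s′} → Step s a s′ → ∃ λ t′ → Step t a t′ × s′ ~[ k ] t′)
    × (∀ {a t′} → Step t a t′ → ∃ λ s′ → Step s a s′ × s′ ~[ k ] t′)

  _≈_ : Conf → Conf → Set
  s ≈ t = ∀ k → s ~[ k ] t

  ~-refl : ∀ k {s} → s ~[ k ] s
  ~-refl zero    = tt
  ~-refl (suc k) = (λ x → _ , x , ~-refl k) , λ x → _ , x , ~-refl k

  ~-sym : ∀ k {s t} → s ~[ k ] t → t ~[ k ] s
  ~-sym zero    _       = tt
  ~-sym (suc k) (f , g) =
    (λ x → let s′ , y , h = g x in s′ , y , ~-sym k h) ,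
    (λ x → let t′ , y , h = f x in t′ , y , ~-sym k h)

  ~-trans : ∀ k {s t u} → s ~[ k ] t → t ~[ k ] u → s ~[ k ] u
  ~-trans zero    _       _         = tt
  ~-trans (suc k) (f , g) (f′ , g′) =
    (λ x → let _ , y , h = f x ; u′ , z , h′ = f′ y in u′ , z , ~-trans k h h′) ,
    (λ x → let _ , y , h = g′ x ; s′ , z , h′ = g y in s′ , z , ~-trans k h′ h)

  ~-pred : ∀ k {s t} → s ~[ suc k ] t → s ~[ k ] t
  ~-pred zero    _       = tt
  ~-pred (suc k) (f , g) =
    (λ x → let t′ , y , h = f x in t′ , y , ~-pred k h) ,
    (λ x → let s′ , y , h = g x in s′ , y , ~-pred k h)

  ~-mono : ∀ {j k s t} → j ≤ k → s ~[ k ] t → s ~[ j ] t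
  ~-mono {j} le = go (≤⇒≤′ le)
    where
    go : ∀ {k s t} → j ≤′ k → s ~[ k ] t → s ~[ j ] t
    go ≤′-refl       h = h
    go (≤′-step le′) h = go le′ (~-pred _ h)

  ≈-refl : ∀ {s} → s ≈ s
  ≈-refl k = ~-refl k

  ≈-sym : ∀ {s t} → s ≈ t → t ≈ s
  ≈-sym h k = ~-sym k (h k)

  ≈-trans : ∀ {s t u} → s ≈ t → t ≈ u → s ≈ u
  ≈-trans h h′ k = ~-trans k (h k) (h′ k)

  private
    FiresTo : Conf → Act → (Conf → Set) → Rule (nQ M) (nΓ M) (nA M) → Set
    FiresTo (q , [])    a R ρ = ⊥
    FiresTo (q , X ∷ σ) a R ρ =
      (Rule.src ρ ≡ q × Rule.top ρ ≡ X × Rule.act ρ ≡ a) × R (Rule.tgt ρ , Rule.push ρ ++ σ)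

    firesTo? : ∀ s a {R : Conf → Set} → (∀ c → Dec (R c)) → ∀ ρ → Dec (FiresTo s a R ρ)
    firesTo? (q , [])    a R? ρ = no λ ()
    firesTo? (q , X ∷ σ) a R? ρ =
      ((Rule.src ρ Finₚ.≟ q) ×-dec ((Rule.top ρ Finₚ.≟ X) ×-dec (Rule.act ρ Finₚ.≟ a)))
        ×-dec R? _

  some-step? : ∀ s a {R : Conf → Set} → (∀ c → Dec (R c)) → Dec (∃ λ s′ → Step s a s′ × R s′)
  some-step? s a R? = map′ (to s) (from s) (any? (firesTo? s a R?) (Δ M))
    where
    to : ∀ s {R} → Any (FiresTo s a R) (Δ M) → ∃ λ s′ → Step s a s′ × R s′
    to (q , []) f with find f
    ... | _ , _ , ()
    to (q , X ∷ σ) f with find f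
    ... | rule _ _ _ _ _ , r∈ , (refl , refl , refl) , r = _ , (_ , _ , r∈ , refl) , r
    from : ∀ s {R} → (∃ λ s′ → Step s a s′ × R s′) → Any (FiresTo s a R) (Δ M)
    from (q , X ∷ σ) (_ , (_ , _ , r∈ , refl) , r) = lose r∈ ((refl , refl , refl) , r)

  every-step? : ∀ s {R : Act → Conf → Set} → (∀ a c → Dec (R a c)) →
                Dec (∀ {a s′} → Step s a s′ → R a s′)
  every-step? s {R} R? with Finₚ.any? (λ a → some-step? s a (λ c → ¬? (R? a c)))
  ... | yes (a , s′ , x , ¬r) = no λ f → ¬r (f x)
  ... | no none = yes λ {a} {s′} x → decidable-stable (R? a s′) λ ¬r → none (a , s′ , x , ¬r)

  ~-dec : ∀ k s t → Dec (s ~[ k ] t)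
  ~-dec zero    s t = yes tt
  ~-dec (suc k) s t =
    every-step? s (λ a s′ → some-step? t a λ t′ → ~-dec k s′ t′) ×-dec
    every-step? t (λ a t′ → some-step? s a λ s′ → ~-dec k s′ t′)

  -- Popping stack words

  -- k bounds the height of the derivation tree of the popping run.
  mutual
    PopsIn : ℕ → Q → Γ → Q → Set
    PopsIn zero    p X r = ⊥
    PopsIn (suc k) p X r = Any (λ ρ → (Rule.src ρ ≡ p × Rule.top ρ ≡ X)
                                     × PopsWordIn k (Rule.tgt ρ) (Rule.push ρ) r) (Δ M)

    PopsWordIn : ℕ → Q → List Γ → Q → Set
    PopsWordIn k p []      r = p ≡ r
    PopsWordIn k p (X ∷ γ) r = ∃ λ s → PopsIn k p X s × PopsWordIn k s γ r

  mutual
    popsIn? : ∀ k p X r → Dec (PopsIn k p X r)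
    popsIn? zero    p X r = no λ ()
    popsIn? (suc k) p X r =
      any? (λ ρ → ((Rule.src ρ Finₚ.≟ p) ×-dec (Rule.top ρ Finₚ.≟ X))
                  ×-dec popsWordIn? k (Rule.tgt ρ) (Rule.push ρ) r) (Δ M)

    popsWordIn? : ∀ k p γ r → Dec (PopsWordIn k p γ r)
    popsWordIn? k p []      r = p Finₚ.≟ r
    popsWordIn? k p (X ∷ γ) r = Finₚ.any? λ s → popsIn? k p X s ×-dec popsWordIn? k s γ r

  mutual
    popsIn-suc : ∀ k {p X r} → PopsIn k p X r → PopsIn (suc k) p X r
    popsIn-suc (suc k) = Any.map λ (eqs , h) → eqs , popsWordIn-suc k _ h

    popsWordIn-suc : ∀ k {p} γ {r} → PopsWordIn k p γ r → PopsWordIn (suc k) p γ r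
    popsWordIn-suc k []      h           = h
    popsWordIn-suc k (X ∷ γ) (s , h , t) = s , popsIn-suc k h , popsWordIn-suc k γ t

  popsWordIn-++⁻ : ∀ k {p} γ {δ r} → PopsWordIn k p (γ ++ δ) r →
                   ∃ λ s → PopsWordIn k p γ s × PopsWordIn k s δ r
  popsWordIn-++⁻ k []      h           = _ , refl , h
  popsWordIn-++⁻ k (X ∷ γ) (s , h , t) =
    let u , h′ , t′ = popsWordIn-++⁻ k γ t in u , (s , h , h′) , t′

  popsWordIn-++⁺ : ∀ k {p} γ {δ s r} → PopsWordIn k p γ s → PopsWordIn k s δ r →
                   PopsWordIn k p (γ ++ δ) r
  popsWordIn-++⁺ k []      refl         h′ = h′
  popsWordIn-++⁺ k (X ∷ γ) (u , h , t) h′ = u , h , popsWordIn-++⁺ k γ t h′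

  abstract
    -- The sets of triples grow with `k` inside a finite set, so some level adds nothing to the one
    -- before. At that level popping is closed under rules.
    height : ∃ λ k → ∀ {x} → x ∈ cartesianProduct (allFin _) (cartesianProduct (allFin _) (allFin _)) →
             PopsIn (suc k) (proj₁ x) (proj₁ (proj₂ x)) (proj₂ (proj₂ x)) →
             PopsIn k (proj₁ x) (proj₁ (proj₂ x)) (proj₂ (proj₂ x))
    height = ascending-chain-stabilises
      (λ k x → PopsIn k (proj₁ x) (proj₁ (proj₂ x)) (proj₂ (proj₂ x)))
      (λ k x → popsIn? k _ _ _) (λ k → popsIn-suc k) _

  private
    normBound : ℕ → ℕ
    normBound zero    = 0
    normBound (suc k) = suc (maxPush * normBound k)

  Pops : Q → List Γ → Q → Set
  Pops = PopsWordIn (proj₁ height)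

  pops? : ∀ p γ r → Dec (Pops p γ r)
  pops? = popsWordIn? (proj₁ height)

  pops-++⁻ : ∀ {p} γ {δ r} → Pops p (γ ++ δ) r → ∃ λ s → Pops p γ s × Pops s δ r
  pops-++⁻ = popsWordIn-++⁻ (proj₁ height)

  pops-++⁺ : ∀ {p} γ {δ s r} → Pops p γ s → Pops s δ r → Pops p (γ ++ δ) r
  pops-++⁺ = popsWordIn-++⁺ (proj₁ height)

  pops-rule : ∀ {p X a q α r} → rule p X a q α ∈ Δ M → Pops q α r → Pops p (X ∷ []) r
  pops-rule {p} {X} {r = r} r∈ h =
    r , proj₂ height {p , X , r}
          (∈-cartesianProduct⁺ (∈-allFin p) (∈-cartesianProduct⁺ (∈-allFin X) (∈-allFin r)))
          (lose r∈ ((refl , refl) , h)) , refl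

  pops-step : ∀ {p γ a q γ′ r} → Step (p , γ) a (q , γ′) → Pops q γ′ r → Pops p γ r
  pops-step {γ = X ∷ γ} (q , α , r∈ , refl) h =
    let s , h₁ , h₂ = pops-++⁻ α h in pops-++⁺ (X ∷ []) {γ} (pops-rule r∈ h₁) h₂

  -- For an empty final stack this is completeness: `Pops` finds every control state in which a run
  -- empties `γ`.
  pops-run : ∀ {p γ w q γ′ r} → Run (p , γ) w (q , γ′) → Pops q γ′ r → Pops p γ r
  pops-run ε       h = h
  pops-run (x ◅ π) h = pops-step x (pops-run π h)

  norm : ℕ
  norm = normBound (proj₁ height)

  pops⇒run : ∀ {p} γ {r} → Pops p γ r →
             ∃ λ w → Run (p , γ) w (r , []) × length w ≤ length γ * norm
  pops⇒run = word (proj₁ height)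
    where
    single : ∀ k {p X r} → PopsIn k p X r →
             ∃ λ w → Run (p , X ∷ []) w (r , []) × length w ≤ normBound k
    word : ∀ k {p} γ {r} → PopsWordIn k p γ r →
           ∃ λ w → Run (p , γ) w (r , []) × length w ≤ length γ * normBound k
    single (suc k) h with find h
    ... | rule p X a q α , r∈ , (refl , refl) , h′ with word k α h′
    ...   | w , π , le = a ∷ w ,
            (q , α , r∈ , cong (q ,_) (sym (++-identityʳ α))) ◅ π ,
            s≤s (≤-trans le (*-monoˡ-≤ (normBound k) (push≤maxPush r∈)))
    word k []      refl = [] , ε , z≤n
    word k (X ∷ γ) (s , h , t) with single k h | word k γ t
    ... | v , π , le | w , π′ , le′ = v ++ w , run-++ γ π ◅◅ π′ ,
          ≤-trans (≤-reflexive (length-++ v)) (+-mono-≤ le le′)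

  -- Replacing the tail below a stack prefix

  cong-~ : ∀ k {p} γ {σ τ} → (∀ {r} → Pops p γ r → (r , σ) ~[ k ] (r , τ)) →
           (p , γ ++ σ) ~[ k ] (p , γ ++ τ)
  -- The first step depends on `X` alone and is over before either tail is exposed, so one level is
  -- gained.
  cong-~⁺ : ∀ k {p X} γ {σ τ} → (∀ {r} → Pops p (X ∷ γ) r → (r , σ) ~[ k ] (r , τ)) →
            (p , X ∷ γ ++ σ) ~[ suc k ] (p , X ∷ γ ++ τ)
  cong-~ k       []      h = h refl
  cong-~ zero    (X ∷ γ) h = tt
  cong-~ (suc k) (X ∷ γ) h = cong-~⁺ k γ λ ps → ~-pred k (h ps)
  cong-~⁺ k {p} {X} γ {σ} {τ} h =
    (λ { (q , α , r∈ , refl) → _ , (q , α , r∈ , refl) , after r∈ }) ,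
    (λ { (q , α , r∈ , refl) → _ , (q , α , r∈ , refl) , after r∈ })
    where
    after : ∀ {a q α} → rule p X a q α ∈ Δ M → (q , α ++ γ ++ σ) ~[ k ] (q , α ++ γ ++ τ)
    after {q = q} {α} r∈ = subst₂ (λ x y → (q , x) ~[ k ] (q , y)) (++-assoc α γ σ) (++-assoc α γ τ)
      (cong-~ k (α ++ γ) λ ps → h (pops-step (q , α , r∈ , refl) ps))

  cong-≈ : ∀ {p} γ {σ τ} → (∀ {r} → Pops p γ r → (r , σ) ≈ (r , τ)) → (p , γ ++ σ) ≈ (p , γ ++ τ)
  cong-≈ γ h k = cong-~ k γ λ ps → h ps k

-- Pumping towards a limit

module Iteration {A : Set} (t : List A) where

  iter : ℕ → List A → List A
  iter zero    σ = σ
  iter (suc n) σ = t ++ iter n σ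

  iter-+ : ∀ m {n σ} → iter (m + n) σ ≡ iter m (iter n σ)
  iter-+ zero    = refl
  iter-+ (suc m) = cong (t ++_) (iter-+ m)

  iter-++ : ∀ n {σ} → iter n σ ≡ iter n [] ++ σ
  iter-++ zero        = refl
  iter-++ (suc n) {σ} = trans (cong (t ++_) (iter-++ n)) (sym (++-assoc t (iter n []) σ))

  iter-comm : ∀ n {σ} → iter n (t ++ σ) ≡ t ++ iter n σ
  iter-comm zero    = refl
  iter-comm (suc n) = cong (t ++_) (iter-comm n)

-- Bounds computed from the automaton and the length of the pumped word

module Bounds (M : PDA) (τ : ℕ) where
  open FiniteStacks M

  confsUpTo : ℕ → List Conf
  confsUpTo n = cartesianProduct (allFin _) (wordsUpTo (allFin _) n)

  ∈-confsUpTo : ∀ n c → length (proj₂ c) ≤ n → c ∈ confsUpTo n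
  ∈-confsUpTo n (p , γ) le =
    ∈-cartesianProduct⁺ (∈-allFin p) (∈-wordsUpTo ∈-allFin n γ le)

  -- `popTime` bounds a run popping `suc norm` copies of the pumped word, `roundLength` the head
  -- while one copy is being popped, and `tailLength` that head together with `norm` copies after
  -- `norm` further steps. `skipLength` covers the rest of a pushed word or of the pumped word.
  popTime roundLength tailLength skipLength headLength : ℕ
  popTime     = suc norm * τ * norm
  roundLength = τ + τ * norm * maxPush
  tailLength  = roundLength + norm * τ + norm * maxPush
  skipLength  = maxPush + τ
  headLength  = popTime + popTime * τ + popTime * maxPush + skipLength

  -- For each control state, a head and then a head for each tail exposed beneath it. The exponents
  -- below those tails are left out, so that short labels are finite in number.
  Label : Set
  Label = Vec (Conf × Vec Conf (nQ M)) (nQ M)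

  Short : Conf × Vec Conf (nQ M) → Set
  Short (c , tails) = length (proj₂ c) ≤ headLength × (∀ r → length (proj₂ (Vec.lookup tails r)) ≤ tailLength)

  abstract
    labels : List Label
    labels = vecsOver (cartesianProduct (confsUpTo headLength) (vecsOver (confsUpTo tailLength) _)) _

    ∈-labels : ∀ l → (∀ r → Short (Vec.lookup l r)) → l ∈ labels
    ∈-labels l h = ∈-vecsOver l λ r → ∈-cartesianProduct⁺ (∈-confsUpTo headLength _ (proj₁ (h r)))
      (∈-vecsOver _ λ r′ → ∈-confsUpTo tailLength _ (proj₂ (h r) r′))

  -- Beyond this index there are more exponents lying at least `norm` below it than labels, so two
  -- of them share a label.
  index : ℕ
  index = norm + length labels

  bottomLength : ℕ
  bottomLength = index * τ * norm * τ + index * τ * norm * maxPush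

  abstract
    bottomLabels : List (Vec Conf (nQ M))
    bottomLabels = vecsOver (confsUpTo bottomLength) _

    ∈-bottomLabels : ∀ l → (∀ r → length (proj₂ (Vec.lookup l r)) ≤ bottomLength) → l ∈ bottomLabels
    ∈-bottomLabels l h = ∈-vecsOver l λ r → ∈-confsUpTo bottomLength _ (h r)

  -- `σ` is rewritten as a head over the limit, the latter given by `index` copies of `t` on `σ`
  -- itself.
  IsBottom : (Q → Set) → List Γ → List Γ → Q → Conf → Set
  IsBottom S t σ r (z , ζ) =
    (r , σ) ≈ (z , ζ ++ Iteration.iter t index σ) × (∀ {r′} → Pops z ζ r′ → S r′)

-- Matching and pumping above a stable level

module Stable (M : PDA)
  (𝓡 : FiniteStacks.Conf M → Set)
  (𝓡-step : ∀ {s a s′} → 𝓡 s → FiniteStacks.Step M s a s′ → 𝓡 s′)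
  (N : ℕ) (stable : ∀ {s t} → 𝓡 s → 𝓡 t → FiniteStacks._~[_]_ M s N t → FiniteStacks._≈_ M s t) where

  open FiniteStacks M

  -- Level `suc N` yields successors that agree up to level `N`, and stability upgrades this to `≈`.
  match : ∀ {s t a s′} → 𝓡 s → 𝓡 t → s ≈ t → Step s a s′ → ∃ λ t′ → Step t a t′ × s′ ≈ t′
  match 𝓡s 𝓡t h x =
    let t′ , y , h′ = proj₁ (h (suc N)) x in t′ , y , stable (𝓡-step 𝓡s x) (𝓡-step 𝓡t y) h′

  match-run : ∀ {s t w s′} → 𝓡 s → 𝓡 t → s ≈ t → Run s w s′ → ∃ λ t′ → Run t w t′ × s′ ≈ t′
  match-run 𝓡s 𝓡t h ε       = _ , ε , h
  match-run 𝓡s 𝓡t h (x ◅ π) =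
    let t′ , y , h′ = match 𝓡s 𝓡t h x
        u , ρ , h″  = match-run (𝓡-step 𝓡s x) (𝓡-step 𝓡t y) h′ π
    in u , y ◅ ρ , h″

  -- `S` will be the set of control states in which the tail is exposed. Closure lets popping stay
  -- inside `S`; surjectivity supplies a start above any number of copies.
  module Pumping (τ : ℕ)
    (X₀ : Γ) (t₀ : List Γ) (t≤τ : suc (length t₀) ≤ τ)
    (S : Q → Set) (S? : ∀ r → Dec (S r))
    (S-closed : ∀ {r r′} → S r → Pops r (X₀ ∷ t₀) r′ → S r′)
    (S-onto : ∀ {r′} → S r′ → ∃ λ r → S r × Pops r (X₀ ∷ t₀) r′) where

    open Bounds M τ

    t : List Γ
    t = X₀ ∷ t₀

    open Iteration t

    length-iter≤ : ∀ n → length (iter n []) ≤ n * τ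
    length-iter≤ zero    = z≤n
    length-iter≤ (suc n) = ≤-trans (≤-reflexive (length-++ t)) (+-mono-≤ t≤τ (length-iter≤ n))

    length-iter≥ : ∀ n → n ≤ length (iter n [])
    length-iter≥ zero    = z≤n
    length-iter≥ (suc n) = s≤s (≤-trans (length-iter≥ n)
      (≤-trans (m≤n+m _ (length t₀)) (≤-reflexive (sym (length-++ t₀)))))

    S-closed-iter : ∀ n {r r′} → S r → Pops r (iter n []) r′ → S r′
    S-closed-iter zero    s refl = s
    S-closed-iter (suc n) s h    =
      let _ , h₁ , h₂ = pops-++⁻ t h in S-closed-iter n (S-closed s h₁) h₂

    S-onto-iter : ∀ n {r′} → S r′ → ∃ λ r → S r × Pops r (iter n []) r′
    S-onto-iter zero    s = _ , s , refl
    S-onto-iter (suc n) s =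
      let _ , s₁ , h₁ = S-onto-iter n s
          r , s₂ , h₂ = S-onto s₁
      in r , s₂ , pops-++⁺ t h₂ h₁

    infix 4 _≋[_]_
    _≋[_]_ : List Γ → ℕ → List Γ → Set
    σ ≋[ k ] ρ = ∀ {r} → S r → (r , σ) ~[ k ] (r , ρ)

    contraction : ∀ n {k σ ρ} → σ ≋[ k ] ρ → iter n σ ≋[ n + k ] iter n ρ
    contraction zero    h s = h s
    contraction (suc n) h s = cong-~⁺ _ t₀ λ ps → contraction n h (S-closed s ps)

    module Bottom (σ : List Γ) (𝓡-iter : ∀ n {r} → S r → 𝓡 (r , iter n σ)) where

      v : ℕ → List Γ
      v n = iter n σ

      Lim : ℕ → Set
      Lim b = ∀ {r} → S r → (r , v b) ≈ (r , v (suc b))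

      -- `σ` and `t ++ σ` agree at level 0, so `N` copies of `t` lift them to level `N`, where
      -- stability applies.
      Lim-N : Lim N
      Lim-N s = stable (𝓡-iter N s) (𝓡-iter (suc N) s)
        (~-mono (m≤m+n N 0) (subst (λ ρ → (_ , v N) ~[ N + 0 ] (_ , ρ)) (iter-comm N)
          (contraction N {0} {σ} {t ++ σ} (λ _ → _) s)))

      Lim-suc : ∀ b → Lim b → Lim (suc b)
      Lim-suc b lim s k = ~-pred k (contraction 1 (λ s′ → lim s′ k) s)

      Lim-+ : ∀ n b → Lim b → ∀ {r} → S r → (r , v b) ≈ (r , v (n + b))
      Lim-+ zero    b lim s = ≈-refl
      Lim-+ (suc n) b lim {r} s = ≈-trans (lim s)
        (subst (λ m → (r , v (suc b)) ≈ (r , v m)) (+-suc n b) (Lim-+ n (suc b) (Lim-suc b lim) s))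

      Lim-mono : ∀ {b b′} → b ≤ b′ → Lim b → Lim b′
      Lim-mono {b} {b′} le lim = subst Lim (m∸n+n≡m le) (up (b′ ∸ b))
        where
        up : ∀ n → Lim (n + b)
        up zero    = lim
        up (suc n) = Lim-suc (n + b) (up n)

      -- Only a lower bound on the exponent matters: it is what contraction uses, and it lets
      -- different exponents share a label.
      record Tail (e : ℕ) (r : Q) (ρ : List Γ) (c : Conf) : Set where
        field
          exponent : ℕ
          e≤       : e ≤ exponent
          eqv      : (r , ρ) ≈ (proj₁ c , proj₂ c ++ v exponent)
          inS      : ∀ {r′} → Pops (proj₁ c) (proj₂ c) r′ → S r′

      tail-weaken : ∀ {e e′ r ρ c} → e ≤ e′ → Tail e′ r ρ c → Tail e r ρ c
      tail-weaken le h = record { Tail h ; e≤ = ≤-trans le (Tail.e≤ h) }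

      Bounded : ℕ → (Conf → Set) → Set
      Bounded n P = ∃ λ c → length (proj₂ c) ≤ n × P c

      -- Lowering the index of the limit

      module _ (b : ℕ) (lim : Lim b) where

        base : List Γ
        base = v b

        -- The suffix ρ was uncovered, up to a short α, at a moment from which popping a single
        -- symbol leads to ρ′; the popping run was matched on the side of the tᵉσ.
        Explained : ℕ → Q → List Γ → List Γ → Set
        Explained e p γ ρ = ∃₂ λ α ρ′ → ρ ≡ α ++ ρ′ × length α ≤ skipLength ×
          (∀ {r} → Pops p (γ ++ α) r → Bounded tailLength (Tail e r (ρ′ ++ base)))

        -- ξ, met while popping copies of t from tᵇσ, is matched by the run p γ from the limit.
        -- The base tᵇσ stands for the limit: it may be replaced by tⁿ⁺ᵇσ at any time.
        record Sim (e : ℕ) (ξ : Conf) (p : Q) (γ : List Γ) : Set where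
          field
            reach     : ∀ n → 𝓡 (p , γ ++ iter n base)
            eqv       : ξ ≈ (p , γ ++ base)
            inS       : ∀ {r} → Pops p γ r → S r
            explained : ∀ γ′ ρ → γ ≡ γ′ ++ ρ → Explained e p γ′ ρ

        base-tail : ∀ {e r} → e ≤ b → S r → Bounded tailLength (Tail e r base)
        base-tail {r = r} le s = (r , []) , z≤n ,
          record { exponent = b ; e≤ = le ; eqv = ≈-refl ; inS = λ { refl → s } }

        initial : ∀ {e r} → e ≤ b → S r → Sim e (r , base) r t
        initial {e} {r} e≤b s = record
          { reach = λ n → subst (λ ρ → 𝓡 (r , ρ)) (cong (t ++_) (iter-+ n)) (𝓡-iter (suc n + b) s)
          ; eqv = lim s
          ; inS = S-closed s
          -- The suffix lies within one copy of `t`, so it is skipped whole and the bare limit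
          -- remains.
          ; explained = λ γ′ ρ eq → ρ , [] , sym (++-identityʳ ρ) ,
              ≤-trans (≤-trans (≤-trans (length-++-≤ʳ ρ {γ′}) (≤-reflexive (cong length (sym eq)))) t≤τ)
                      (m≤n+m τ maxPush) ,
              λ ps → base-tail e≤b (S-closed s (subst (λ δ → Pops r δ _) (sym eq) ps))
          }

        weaken : ∀ {e e′ ξ p γ} → e ≤ e′ → Sim e′ ξ p γ → Sim e ξ p γ
        weaken le sim = record
          { Sim sim
          ; explained = λ γ′ ρ eq →
              let α , ρ′ , q , len , h = Sim.explained sim γ′ ρ eq
              in α , ρ′ , q , len , λ ps → let c , len′ , tl = h ps in c , len′ , tail-weaken le tl }

        -- Once its head is exhausted the run stands on the limit, which absorbs a fresh copy of
        -- `t`.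
        nonempty : ∀ {e ξ p γ} → e ≤ b → Sim e ξ p γ → ∃₂ λ Y γ₀ → Sim e ξ p (Y ∷ γ₀)
        nonempty {γ = Y ∷ γ₀} e≤b sim = Y , γ₀ , sim
        nonempty {γ = []}     e≤b sim = X₀ , t₀ , record
          { Sim i ; eqv = ≈-trans (Sim.eqv sim) (Sim.eqv i) }
          where i = initial e≤b (Sim.inS sim refl)

        round-step : ∀ {e z ζ a z′ ζ′ p Y γ₀} → length ζ ≤ roundLength →
          (∀ {r} → Pops z ζ r → S r) → 𝓡 (z , ζ ++ v (norm + e)) →
          Sim e (z , ζ ++ v (norm + e)) p (Y ∷ γ₀) → Step (z , ζ) a (z′ , ζ′) →
          ∃₂ (Sim e (z′ , ζ′ ++ v (norm + e)))
        round-step {e} {z} {ζ} {p = p} {Y} {γ₀} ζ≤ ζ-S 𝓡ξ sim x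
          with match 𝓡ξ (Sim.reach sim 0) (Sim.eqv sim) (step-++ (v (norm + e)) x)
        ... | _ , (q , α , r∈ , refl) , h = q , α ++ γ₀ , record
          { reach = λ n → subst (λ ρ → 𝓡 (q , ρ)) (sym (++-assoc α γ₀ _))
                      (𝓡-step (Sim.reach sim n) (q , α , r∈ , refl))
          ; eqv = subst (λ ρ → _ ≈ (q , ρ)) (sym (++-assoc α γ₀ base)) h
          ; inS = λ ps → Sim.inS sim (pops-step (q , α , r∈ , refl) ps)
          ; explained = expl
          }
          where
          -- Popping `Y` takes at most `norm` steps, and the matching run starts with `norm` copies
          -- of `t` above `v e`. It therefore leaves `v e` untouched, and its end describes the
          -- uncovered stack.
          popped : ∀ {r} → Pops p (Y ∷ []) r → Bounded tailLength (Tail e r (γ₀ ++ base))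
          popped {r} ps with pops⇒run (Y ∷ []) ps
          ... | w , π , w≤ with match-run (Sim.reach sim 0) 𝓡ξ (≈-sym (Sim.eqv sim)) (run-++ (γ₀ ++ base) π)
          ... | c , π′ , h′ with run-untouched (ζ ++ iter norm [])
                  (≤-trans w≤ (≤-trans (≤-reflexive (+-identityʳ norm))
                    (≤-trans (length-iter≥ norm) (length-++-≤ʳ _ {ζ}))))
                  (subst (λ ρ → Run (z , ρ) w c)
                    (trans (cong (ζ ++_) (trans (iter-+ norm) (iter-++ norm)))
                           (sym (++-assoc ζ (iter norm []) (v e)))) π′)
          ... | z″ , ζ″ , π″ , refl = (z″ , ζ″) ,
                ≤-trans (run-length π″)
                  (+-mono-≤ (≤-trans (≤-reflexive (length-++ ζ)) (+-mono-≤ ζ≤ (length-iter≤ norm)))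
                            (*-monoˡ-≤ maxPush (≤-trans w≤ (≤-reflexive (+-identityʳ norm))))) ,
                record { exponent = e ; e≤ = ≤-refl ; eqv = h′
                       ; inS = λ ps′ → let _ , h₁ , h₂ = pops-++⁻ ζ (pops-run π″ ps′)
                                       in S-closed-iter norm (ζ-S h₁) h₂ }
          expl : ∀ γ′ ρ → α ++ γ₀ ≡ γ′ ++ ρ → Explained e q γ′ ρ
          expl γ′ ρ eq with ++-split α {bs = γ₀} {cs = γ′} {ds = ρ} eq
          -- The suffix was present before this step; its earlier explanation applies with `Y` back
          -- on top.
          ... | inj₁ (γ″ , γ′≡ , γ₀≡) =
                let β , ρ′ , ρ≡ , len , tails = Sim.explained sim (Y ∷ γ″) ρ (cong (Y ∷_) γ₀≡)
                in β , ρ′ , ρ≡ , len , λ {r} ps →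
                   tails (pops-step (q , α , r∈ , refl)
                     (subst (λ δ → Pops q δ r) (trans (cong (_++ β) γ′≡) (++-assoc α γ″ β)) ps))
          -- The suffix starts inside the pushed word. Skipping to the end of that word makes the
          -- remaining pops those of `Y`.
          ... | inj₂ (α′ , α≡ , ρ≡) =
                α′ , γ₀ , ρ≡ ,
                ≤-trans (≤-trans (length-++-≤ʳ α′ {γ′}) (≤-reflexive (cong length (sym α≡))))
                  (≤-trans (push≤maxPush r∈) (m≤m+n maxPush τ)) ,
                λ {r} ps → popped (pops-rule r∈ (subst (λ δ → Pops q δ r) (sym α≡) ps))

        round : ∀ {e z ζ w z′ ζ′ p γ} → e ≤ b → length ζ + length w * maxPush ≤ roundLength →
          (∀ {r} → Pops z ζ r → S r) → 𝓡 (z , ζ ++ v (norm + e)) →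
          Sim e (z , ζ ++ v (norm + e)) p γ → Run (z , ζ) w (z′ , ζ′) →
          ∃₂ (Sim e (z′ , ζ′ ++ v (norm + e)))
        round e≤b len ζ-S 𝓡ξ sim ε = _ , _ , sim
        round {e} {ζ = ζ} {w = a ∷ w} e≤b len ζ-S 𝓡ξ sim (x ◅ π) =
          let _ , _ , sim₁ = nonempty e≤b sim
              _ , _ , sim₂ = round-step (≤-trans (m≤m+n _ _) len) ζ-S 𝓡ξ sim₁ x
          in round e≤b
               (≤-trans (+-monoˡ-≤ _ (step-length x))
                 (≤-trans (≤-reflexive (+-assoc (length ζ) maxPush _)) len))
               (λ ps → ζ-S (pops-step x ps)) (𝓡-step 𝓡ξ (step-++ (v (norm + e)) x)) sim₂ π

        -- `i` counts the rounds: from exponent `b` each round pops one copy of `t` and lowers `e`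
        -- by one, keeping `norm` copies in reserve above `v e`.
        simulation : ∀ i e → i + (norm + e) ≡ b → ∀ {r} → S r → ∃₂ (Sim e (r , v (norm + e)))
        simulation zero e refl s = _ , t , initial (m≤n+m e norm) s
        simulation (suc i) e eq s =
          let r₀ , s₀ , ps = S-onto s
              w , π , w≤ = pops⇒run t ps
              eq′ : i + (norm + suc e) ≡ b
              eq′ = trans (trans (cong (i +_) (+-suc norm e)) (+-suc i _)) eq
              p , γ , sim = simulation i (suc e) eq′ s₀
          in round (≤-trans (m≤n+m e norm) (≤-trans (m≤n+m _ (suc i)) (≤-reflexive eq)))
               (+-mono-≤ t≤τ (*-monoˡ-≤ maxPush (≤-trans w≤ (*-monoˡ-≤ norm t≤τ))))
               (S-closed s₀)
               (𝓡-iter (suc (norm + e)) s₀)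
               (subst (λ n → Sim e (r₀ , v n) p γ) (+-suc norm e) (weaken (n≤1+n e) sim)) π

        IsRep : ℕ → Q → Conf × Vec Conf (nQ M) → Set
        IsRep n r ((p , B) , tails) = ∃ λ ρ → (r , v n) ≈ (p , B ++ ρ) ×
          (∀ {r′} → Pops p B r′ → Tail (suc n) r′ ρ (Vec.lookup tails r′))

        bounded-tails : ∀ {e p B ρ} → (∀ {r} → Pops p B r → Bounded tailLength (Tail e r ρ)) →
          ∃ λ (tails : Vec Conf (nQ M)) → (∀ r → length (proj₂ (Vec.lookup tails r)) ≤ tailLength) ×
            (∀ {r} → Pops p B r → Tail e r ρ (Vec.lookup tails r))
        bounded-tails {e} {p} {B} {ρ} h =
          let tails , good = tabulate-choice pick
          in tails , (λ r → proj₁ (good r)) ,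
             λ {r} → proj₂ (good r)
          where
          pick : ∀ r → ∃ λ c → length (proj₂ c) ≤ tailLength × (Pops p B r → Tail e r ρ c)
          pick r with pops? p B r
          ... | yes ps = let c , len , tl = h ps in c , len , λ _ → tl
          ... | no ¬ps = (r , []) , z≤n , λ ps → contradiction ps ¬ps

        -- Popping `suc norm` copies from `v (norm + suc n)` ends in `v n`, while the explanations
        -- gathered so far have exponents at least `suc n`. This strict gap drives the later gain of
        -- a level.
        represent : ∀ n → norm + suc n ≤ b → ∀ {r} → S r → ∃ λ ((p , B) : Conf) → ∃ λ ρ →
          length B ≤ headLength × (r , v n) ≈ (p , B ++ ρ) ×
          (∀ {r′} → Pops p B r′ → Bounded tailLength (Tail (suc n) r′ ρ))
        represent n le {r} s = cases
          where
          n<b : suc n ≤ b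
          n<b = ≤-trans (m≤n+m (suc n) norm) le
          onto = S-onto-iter (suc norm) s
          r₀ = proj₁ onto
          s₀ = proj₁ (proj₂ onto)
          path = pops⇒run (iter (suc norm) []) (proj₂ (proj₂ onto))
          w = proj₁ path
          w≤ : length w ≤ popTime
          w≤ = ≤-trans (proj₂ (proj₂ path)) (*-monoˡ-≤ norm (length-iter≤ (suc norm)))
          start≡ : iter (suc norm) [] ++ v n ≡ v (norm + suc n)
          start≡ = trans (sym (iter-++ (suc norm))) (trans (sym (iter-+ (suc norm))) (cong v (sym (+-suc norm n))))
          π : Run (r₀ , v (norm + suc n)) w (r , v n)
          π = subst (λ ρ → Run (r₀ , ρ) w (r , v n)) start≡ (run-++ (v n) (proj₁ (proj₂ path)))
          𝓡₀ = 𝓡-iter (norm + suc n) s₀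
          simulated = simulation (b ∸ (norm + suc n)) (suc n) (m∸n+n≡m le) s₀
          p = proj₁ simulated
          γ = proj₁ (proj₂ simulated)
          sim = proj₂ (proj₂ simulated)

          cases : ∃ λ ((p , B) : Conf) → ∃ λ ρ →
            length B ≤ headLength × (r , v n) ≈ (p , B ++ ρ) ×
            (∀ {r′} → Pops p B r′ → Bounded tailLength (Tail (suc n) r′ ρ))
          cases with popTime ≤? length γ
          -- The matching run stays within the top `popTime` symbols, and the suffix beneath them
          -- has an explanation.
          ... | yes long =
            let γ₁ = take popTime γ
                γ₂ = drop popTime γ
                γ≡ = take++drop≡id popTime γ
                len₁ : length γ₁ ≡ popTime
                len₁ = trans (length-take popTime γ) (m≤n⇒m⊓n≡m long)
                α , ρ′ , γ₂≡ , α≤ , tails = Sim.explained sim γ₁ γ₂ (sym γ≡)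
                c , π′ , h = match-run 𝓡₀ (Sim.reach sim 0) (Sim.eqv sim) π
                p′ , γ′ , π″ , c≡ = run-untouched γ₁ {γ₂ ++ base}
                  (≤-trans w≤ (≤-reflexive (sym len₁)))
                  (subst (λ ρ → Run (p , ρ) w c)
                    (trans (cong (_++ base) (sym γ≡)) (++-assoc γ₁ γ₂ base)) π′)
            in (p′ , γ′ ++ α) , ρ′ ++ base ,
               ≤-trans (≤-reflexive (length-++ γ′))
                 (+-mono-≤ (≤-trans (run-length π″)
                   (+-mono-≤ (≤-trans (≤-reflexive len₁) (m≤m+n popTime _)) (*-monoˡ-≤ maxPush w≤))) α≤) ,
               subst ((r , v n) ≈_) (trans c≡ (cong (p′ ,_)
                 (trans (cong (λ δ → γ′ ++ δ ++ base) γ₂≡)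
                   (trans (cong (γ′ ++_) (++-assoc α ρ′ base)) (sym (++-assoc γ′ α _)))))) h ,
               λ ps → let _ , h₁ , h₂ = pops-++⁻ γ′ ps in tails (pops-++⁺ γ₁ (pops-run π″ h₁) h₂)
          -- The head may not shield the limit, so `popTime` copies of `t`, absorbed by the limit,
          -- are inserted between them.
          ... | no short =
            let γ₁ = γ ++ iter popTime []
                c , π′ , h = match-run 𝓡₀ (Sim.reach sim popTime)
                  (≈-trans (Sim.eqv sim) (cong-≈ γ λ ps →
                    subst (λ δ → (_ , base) ≈ (_ , δ)) (iter-+ popTime)
                      (Lim-+ popTime b lim (Sim.inS sim ps)))) π
                p′ , γ′ , π″ , c≡ = run-untouched γ₁ {base}
                  (≤-trans w≤ (≤-trans (length-iter≥ popTime) (length-++-≤ʳ _ {γ})))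
                  (subst (λ ρ → Run (p , ρ) w c)
                    (trans (cong (γ ++_) (iter-++ popTime)) (sym (++-assoc γ _ base))) π′)
            in (p′ , γ′) , base ,
               ≤-trans (run-length π″)
                 (≤-trans (+-mono-≤ (≤-trans (≤-reflexive (length-++ γ))
                     (+-mono-≤ (<⇒≤ (≰⇒> short)) (length-iter≤ popTime))) (*-monoˡ-≤ maxPush w≤))
                   (m≤m+n _ skipLength)) ,
               subst ((r , v n) ≈_) c≡ h ,
               λ ps → let _ , h₁ , h₂ = pops-++⁻ γ (pops-run π″ ps)
                      in base-tail n<b (S-closed-iter popTime (Sim.inS sim h₁) h₂)

        labelled : ∀ n → norm + suc n ≤ b →
          ∃ λ (l : Label) → l ∈ labels × (∀ {r} → S r → IsRep n r (Vec.lookup l r))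
        labelled n le =
          let l , good = tabulate-choice pick
          in l , ∈-labels l (λ r → proj₁ (good r)) , λ {r} → proj₂ (good r)
          where
          pick : ∀ r → ∃ λ c → Short c × (S r → IsRep n r c)
          pick r with S? r
          ... | yes s =
            let c , ρ , len , eqv , h = represent n le s
                tails , tails≤ , tl = bounded-tails h
            in (c , tails) , (len , tails≤) , λ _ → ρ , eqv , tl
          ... | no ¬s =
            let tails , good = tabulate-choice {P = λ _ c → length (proj₂ c) ≤ tailLength} (λ r′ → (r′ , []) , z≤n)
            in ((r , []) , tails) ,
               (z≤n , good) ,
               λ s → contradiction s ¬s

        module _ {n m : ℕ} (n<m : n < m) (l : Label)
          (repₙ : ∀ {r} → S r → IsRep n r (Vec.lookup l r))
          (repₘ : ∀ {r} → S r → IsRep m r (Vec.lookup l r)) where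

          -- At least one copy of `t` separates `v e` from `v n`, which gains a level, and the limit
          -- absorbs the copies on its side.
          above : ∀ {k} → v n ≋[ k ] base → ∀ {e} → n < e → v e ≋[ suc k ] base
          above {k} h {e} n<e {r} s = ~-trans (suc k)
            (subst (λ ρ → (r , ρ) ~[ suc k ] (r , iter j base)) ve≡
              (~-mono (+-monoˡ-≤ k (m<n⇒0<n∸m n<e)) (contraction j h s)))
            (≈-sym (subst (λ ρ → (r , base) ≈ (r , ρ)) (iter-+ j) (Lim-+ j b lim s)) (suc k))
            where
            j = e ∸ n
            ve≡ : iter j (v n) ≡ v e
            ve≡ = trans (sym (iter-+ j)) (cong v (m∸n+n≡m (<⇒≤ n<e)))

          -- The tails carry exponents above n, so agreement of v n with the limit up to
          -- level k makes the tails of both representations agree up to level k + 1.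
          same-label : ∀ k → v n ≋[ k ] base
          same-label zero    s = _
          same-label (suc k) {r} s =
            let ρₙ , eqₙ , tailₙ = repₙ s
                ρₘ , eqₘ , tailₘ = repₘ s
                (p , B) , tails = Vec.lookup l r
                agree : ∀ {r′} → Pops p B r′ → (r′ , ρₙ) ~[ suc k ] (r′ , ρₘ)
                agree {r′} ps =
                  let open Tail
                      ζ = proj₂ (Vec.lookup tails r′)
                  in ~-trans (suc k) (eqv (tailₙ ps) (suc k))
                    (~-trans (suc k) (cong-~ (suc k) ζ λ ps′ →
                        ~-trans (suc k) (above (same-label k) (e≤ (tailₙ ps)) (inS (tailₙ ps) ps′))
                          (~-sym (suc k) (above (same-label k)
                            (≤-trans (s≤s (<⇒≤ n<m)) (e≤ (tailₘ ps))) (inS (tailₘ ps) ps′))))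
                      (≈-sym (eqv (tailₘ ps)) (suc k)))
            in ~-trans (suc k) (eqₙ (suc k))
              (~-trans (suc k) (cong-~ (suc k) B agree)
                (~-trans (suc k) (≈-sym eqₘ (suc k)) (above (same-label k) n<m s)))

          Lim-lower : Lim n
          Lim-lower s k = ~-trans k (same-label k s)
            (~-sym k (~-pred k (above (same-label k) (n<1+n n) s)))

        descent : index < b → ∃ λ n → n < b × Lim n
        descent index<b =
          let i , j , i<j , eq = pigeonhole-∈ labels many (λ i → proj₁ (at i)) (λ i → proj₁ (proj₂ (at i)))
          in toℕ i , ≤-trans (Finₚ.toℕ<n i) (m∸n≤m b norm) ,
             Lim-lower i<j (proj₁ (at i)) (proj₂ (proj₂ (at i)))
               (subst (λ l → ∀ {r} → S r → IsRep (toℕ j) r (Vec.lookup l r)) (sym eq) (proj₂ (proj₂ (at j))))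
          where
          many : length labels < b ∸ norm
          many = ≤-trans (≤-reflexive (trans (cong suc (sym (m+n∸m≡n norm (length labels))))
                                             (sym (+-∸-assoc 1 (m≤m+n norm (length labels))))))
                         (∸-monoˡ-≤ norm index<b)
          at : (i : Fin (b ∸ norm)) →
               ∃ λ (l : Label) → l ∈ labels × (∀ {r} → S r → IsRep (toℕ i) r (Vec.lookup l r))
          at i = labelled (toℕ i) (≤-trans (+-monoʳ-≤ norm (Finₚ.toℕ<n i))
            (≤-reflexive (m+[n∸m]≡n (≤-trans (m≤m+n norm _) (<⇒≤ index<b)))))

      -- The descent starts at the given `N` but stops at an index computed from `M` and `τ` alone.
      Lim-index : Lim index
      Lim-index = <-rec (λ b → Lim b → Lim index) go N Lim-N
        where
        go : ∀ b → (∀ {b′} → b′ < b → Lim b′ → Lim index) → Lim b → Lim index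
        go b ih lim with index <? b
        ... | yes lt = let n , n<b , lim′ = descent b lim lt in ih n<b lim′
        ... | no ¬lt = Lim-mono (≮⇒≥ ¬lt) lim

      -- Describing a tail by heads over its limit

      bottom : ∀ {r} → S r → Bounded bottomLength (IsBottom S t σ r)
      bottom {r} s =
        let r₀ , s₀ , ps = S-onto-iter index s
            w , π , len = pops⇒run (iter index []) ps
            T = index * τ * norm
            w≤ : length w ≤ T
            w≤ = ≤-trans len (*-monoˡ-≤ norm (length-iter≤ index))
            -- The run popping down to `σ` is matched from `T` additional copies of `t`; having at
            -- most `T` steps, it cannot get below them.
            c , π′ , h = match-run (𝓡-iter index s₀) (𝓡-iter (T + index) s₀) (Lim-+ T index Lim-index s₀)
              (subst (λ ρ → Run (r₀ , ρ) w (r , σ)) (sym (iter-++ index)) (run-++ σ π))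
            z , ζ , π″ , c≡ = run-untouched (iter T []) (≤-trans w≤ (length-iter≥ T))
              (subst (λ ρ → Run (r₀ , ρ) w c) (trans (iter-+ T) (iter-++ T)) π′)
        in (z , ζ) ,
           ≤-trans (run-length π″) (+-mono-≤ (length-iter≤ T) (*-monoˡ-≤ maxPush w≤)) ,
           subst ((r , σ) ≈_) c≡ h , λ ps′ → S-closed-iter T s₀ (pops-run π″ ps′)

      bottoms : ∃ λ l → l ∈ bottomLabels × (∀ {r} → S r → IsBottom S t σ r (Vec.lookup l r))
      bottoms =
        let l , good = tabulate-choice pick
        in l , ∈-bottomLabels l (λ r → proj₁ (good r)) , λ {r} → proj₂ (good r)
        where
        pick : ∀ r → ∃ λ c → length (proj₂ c) ≤ bottomLength × (S r → IsBottom S t σ r c)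
        pick r with S? r
        ... | yes s = let c , len , h = bottom s in c , len , λ _ → h
        ... | no ¬s = (r , []) , z≤n , λ s → contradiction s ¬s

    -- All tails have the same limit, since `k` copies of `t` force agreement up to level `k`. Equal
    -- bottoms thus put the same heads on equivalent limits.
    bottoms-determine : ∀ {σ ρ}
      (𝓡σ : ∀ n {r} → S r → 𝓡 (r , iter n σ)) (𝓡ρ : ∀ n {r} → S r → 𝓡 (r , iter n ρ))
      (l : Vec Conf (nQ M)) →
      (∀ {r} → S r → IsBottom S t σ r (Vec.lookup l r)) →
      (∀ {r} → S r → IsBottom S t ρ r (Vec.lookup l r)) →
      ∀ {r} → S r → (r , σ) ≈ (r , ρ)
    bottoms-determine {σ} {ρ} 𝓡σ 𝓡ρ l isBσ isBρ {r} s =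
      let hσ , inS = isBσ s
          hρ , _   = isBρ s
      in ≈-trans hσ (≈-trans (cong-≈ (proj₂ (Vec.lookup l r)) λ ps → limits (inS ps)) (≈-sym hρ))
      where
      module Bσ = Bottom σ 𝓡σ
      module Bρ = Bottom ρ 𝓡ρ
      limits : ∀ {r} → S r → (r , iter index σ) ≈ (r , iter index ρ)
      limits {r} s k = ~-trans k
        (subst (λ δ → (r , iter index σ) ~[ k ] (r , δ)) (iter-+ k) (Bσ.Lim-+ k index Bσ.Lim-index s k))
        (~-trans k
          (~-mono (m≤m+n k 0) (contraction k {0} (λ _ → _) s))
          (~-sym k (subst (λ δ → (r , iter index ρ) ~[ k ] (r , δ)) (iter-+ k) (Bρ.Lim-+ k index Bρ.Lim-index s k))))

-- Cutting tall configurations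

module Shrinking (M : PDA) (p₀ : Fin (nQ M)) (α₀ : List (Fin (nΓ M))) where

  open FiniteStacks M

  Path : Conf → Conf → Set
  Path s t = ∃ λ w → Run s w t

  infixr 5 _◆_
  _◆_ : ∀ {s t u} → Path s t → Path t u → Path s u
  (_ , π) ◆ (_ , ρ) = _ , π ◅◅ ρ

  path-++ : ∀ {p γ q γ′} σ → Path (p , γ) (q , γ′) → Path (p , γ ++ σ) (q , γ′ ++ σ)
  path-++ σ (_ , π) = _ , run-++ σ π

  Reach : Conf → Set
  Reach = Path (p₀ , α₀)

  -- Stairs of a run: configurations q Y σ from which the run never touches σ again.
  data Chain : Q → Γ → List Γ → Set where
    bottom : ∀ {q Y σ} → Reach (q , Y ∷ σ) → length σ ≤ length α₀ → Chain q Y σ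
    extend : ∀ {q Y σ q′ Y′ t} → Chain q Y σ → Path (q , Y ∷ []) (q′ , Y′ ∷ t) →
             0 < length t → length t ≤ maxPush → Chain q′ Y′ (t ++ σ)

  Top : Conf → Set
  Top (p , [])    = ⊤
  Top (p , X ∷ σ) = Chain p X σ

  short-top : ∀ {r} α → Reach (r , α) → length α ≤ length α₀ → Top (r , α)
  short-top []      ρ le = tt
  short-top (X ∷ α) ρ le = bottom ρ (≤-trans (n≤1+n _) le)

  -- A pop merges the top stair into the one beneath, a single symbol prolongs its path, and a
  -- longer word opens a new stair.
  advance : ∀ {q Y σ r} β → Chain q Y σ → Path (q , Y ∷ []) (r , β) → length β ≤ suc maxPush →
            Top (r , β ++ σ)
  advance {σ = σ} [] (bottom ρ le) π _ = short-top σ (ρ ◆ path-++ σ π) le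
  advance [] (extend {t = t} c π′ _ le) π _ = advance t c (π′ ◆ path-++ t π) (m≤n⇒m≤1+n le)
  advance {σ = σ} (Y′ ∷ []) (bottom ρ le) π _ = bottom (ρ ◆ path-++ σ π) le
  advance (Y′ ∷ []) (extend {t = t} c π′ lt le) π _ = extend c (π′ ◆ path-++ t π) lt le
  advance (Y′ ∷ Z ∷ β) c π (s≤s le) = extend c π (s≤s z≤n) le

  top-step : ∀ {s a s′} → Top s → Step s a s′ → Top s′
  top-step {p , X ∷ σ} c (q , α , r∈ , refl) =
    advance α c (_ , (q , α , r∈ , cong (q ,_) (sym (++-identityʳ α))) ◅ ε) (m≤n⇒m≤1+n (push≤maxPush r∈))

  top-run : ∀ {s w s′} → Top s → Run s w s′ → Top s′
  top-run h ε       = h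
  top-run h (x ◅ π) = top-run (top-step h x) π

  top : ∀ {s} → Reach s → Top s
  top (_ , π) = top-run (short-top α₀ (_ , ε) ≤-refl) π

  depth : ∀ {q Y σ} → Chain q Y σ → ℕ
  depth (bottom _ _)     = 0
  depth (extend c _ _ _) = suc (depth c)

  length≤depth : ∀ {q Y σ} (c : Chain q Y σ) → length σ ≤ length α₀ + depth c * maxPush
  length≤depth (bottom _ le) = ≤-trans le (m≤m+n _ 0)
  length≤depth (extend {t = t} c _ _ le) = ≤-trans (≤-reflexive (length-++ t))
    (≤-trans (+-mono-≤ le (length≤depth c)) (≤-reflexive
      (trans (sym (+-assoc maxPush (length α₀) _))
        (trans (cong (_+ depth c * maxPush) (+-comm maxPush (length α₀))) (+-assoc (length α₀) maxPush _)))))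

  chain-reach : ∀ {q Y σ} → Chain q Y σ → Reach (q , Y ∷ σ)
  chain-reach (bottom ρ _) = ρ
  chain-reach (extend {σ = σ} c π _ _) = chain-reach c ◆ path-++ σ π

  record Level : Set where
    constructor level
    field
      {state} : Q
      {symbol} : Γ
      {stack} : List Γ
      chain : Chain state symbol stack
  open Level

  down : Level → Level
  down (level (bottom ρ le))     = level (bottom ρ le)
  down (level (extend c _ _ _)) = level c

  downs : ℕ → Level → Level
  downs zero    ℓ = ℓ
  downs (suc n) ℓ = down (downs n ℓ)

  height-down : ∀ ℓ → depth (chain (down ℓ)) ≡ pred (depth (chain ℓ))
  height-down (level (bottom _ _))     = refl
  height-down (level (extend _ _ _ _)) = refl

  height-downs : ∀ n ℓ → depth (chain (downs n ℓ)) ≡ depth (chain ℓ) ∸ n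
  height-downs zero    ℓ = refl
  height-downs (suc n) ℓ = trans (height-down (downs n ℓ))
    (trans (cong pred (height-downs n ℓ)) (pred[m∸n]≡m∸[1+n] (depth (chain ℓ)) n))

  shorter-down : ∀ ℓ → 0 < depth (chain ℓ) → length (stack (down ℓ)) < length (stack ℓ)
  shorter-down (level (extend {t = t} c _ lt _)) _ =
    ≤-trans (+-monoˡ-≤ _ lt) (≤-reflexive (sym (length-++ t)))

  shorter-downs : ∀ k n ℓ → k + n < depth (chain ℓ) →
                  length (stack (downs (suc k + n) ℓ)) < length (stack (downs n ℓ))
  shorter-downs k n ℓ lt with shorter-down (downs (k + n) ℓ)
    (≤-trans (m<n⇒0<n∸m lt) (≤-reflexive (sym (height-downs (k + n) ℓ))))
  shorter-downs zero    n ℓ lt | h = h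
  shorter-downs (suc k) n ℓ lt | h = <-trans h (shorter-downs k n ℓ (≤-trans (n≤1+n _) lt))

  Below : ℕ → Level → Level → Set
  Below k ℓ ℓ′ = ∃ λ t → stack ℓ′ ≡ t ++ stack ℓ × length t ≤ k * maxPush ×
                 Path (state ℓ , symbol ℓ ∷ []) (state ℓ′ , symbol ℓ′ ∷ t)

  down-below : ∀ ℓ → Below 1 (down ℓ) ℓ
  down-below (level (bottom _ _)) = [] , refl , z≤n , _ , ε
  down-below (level (extend {t = t} c π _ le)) = t , refl , ≤-trans le (m≤m+n maxPush 0) , π

  downs-below : ∀ k n ℓ → Below k (downs (k + n) ℓ) (downs n ℓ)
  downs-below zero    n ℓ = [] , refl , z≤n , _ , ε
  downs-below (suc k) n ℓ =
    let t , eq , le , π = downs-below k n ℓ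
        u , eq′ , le′ , π′ = down-below (downs (k + n) ℓ)
    in t ++ u , trans eq (trans (cong (t ++_) eq′) (sym (++-assoc t u _))) ,
       ≤-trans (≤-reflexive (trans (length-++ t) (+-comm (length t) _)))
         (+-mono-≤ (≤-trans le′ (≤-reflexive (+-identityʳ maxPush))) le) ,
       π′ ◆ path-++ u π

  -- The last component is the set of control states in which the tail below is exposed
  -- from the top configuration.
  Colour : Set
  Colour = Q × Γ × Vec Bool (nQ M)

  abstract
    colours : List Colour
    colours = cartesianProduct (allFin _) (cartesianProduct (allFin _) (vecsOver (true ∷ false ∷ []) _))

    ∈-colours : ∀ c → c ∈ colours
    ∈-colours (q , Y , V) = ∈-cartesianProduct⁺ (∈-allFin q) (∈-cartesianProduct⁺ (∈-allFin Y)
      (∈-vecsOver V λ i → ∈-bool (Vec.lookup V i)))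
      where
      ∈-bool : ∀ x → x ∈ true ∷ false ∷ []
      ∈-bool true  = here refl
      ∈-bool false = there (here refl)

  -- With one level more than there are colours, each window repeats a colour; the word between the
  -- two levels has length at most `τ`.
  window τ : ℕ
  window = suc (length colours)
  τ      = window * maxPush

  open Bounds M τ

  -- The colour, the pumped word and the bottoms: the data that two tails must share for
  -- `bottoms-determine` to identify them.
  Code : Set
  Code = Colour × Γ × List Γ × Vec Conf (nQ M)

  abstract
    codes : List Code
    codes = cartesianProduct colours (cartesianProduct (allFin _)
              (cartesianProduct (wordsUpTo (allFin _) τ) bottomLabels))

    ∈-codes : ∀ {c X₀ t₀ l} → length t₀ ≤ τ → l ∈ bottomLabels → (c , X₀ , t₀ , l) ∈ codes
    ∈-codes t≤ l∈ = ∈-cartesianProduct⁺ (∈-colours _) (∈-cartesianProduct⁺ (∈-allFin _)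
      (∈-cartesianProduct⁺ (∈-wordsUpTo ∈-allFin τ _ t≤) l∈))

  heightBound : ℕ
  heightBound = suc (length α₀ + suc (length codes) * window * maxPush)

  In : Vec Bool (nQ M) → Q → Set
  In V r = Vec.lookup V r ≡ true

  popSet : Q → List Γ → Vec Bool (nQ M)
  popSet p γ = Vec.tabulate λ r → does (pops? p γ r)

  popSet⇒pops : ∀ {p γ r} → In (popSet p γ) r → Pops p γ r
  popSet⇒pops {p} {γ} {r} eq with pops? p γ r | trans (sym (Vecₚ.lookup∘tabulate (λ r → does (pops? p γ r)) r)) eq
  ... | yes ps | _ = ps

  pops⇒popSet : ∀ {p γ r} → Pops p γ r → In (popSet p γ) r
  pops⇒popSet {p} {γ} {r} ps = trans (Vecₚ.lookup∘tabulate (λ r → does (pops? p γ r)) r) claim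
    where
    claim : does (pops? p γ r) ≡ true
    claim with pops? p γ r
    ... | yes _  = refl
    ... | no ¬ps = contradiction ps ¬ps

  -- The pumping hypotheses with `V` as the set of control states; `around` and `expose` make all
  -- pumped configurations reachable.
  record Loop (V : Vec Bool (nQ M)) (q : Q) (Y X₀ : Γ) (t₀ : List Γ) : Set where
    field
      len    : suc (length t₀) ≤ τ
      around : Path (q , Y ∷ []) (q , Y ∷ X₀ ∷ t₀)
      closed : ∀ {r r′} → In V r → Pops r (X₀ ∷ t₀) r′ → In V r′
      onto   : ∀ {r′} → In V r′ → ∃ λ r → In V r × Pops r (X₀ ∷ t₀) r′
      expose : ∀ {r} → In V r → Path (q , Y ∷ []) (r , [])

  -- Loops between levels and excision

  module _ (N : ℕ) (stable : ∀ {s t} → Reach s → Reach t → s ~[ N ] t → s ≈ t) where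

    module Looping {V q Y X₀ t₀} (L : Loop V q Y X₀ t₀) where
      open Loop L
      open Stable.Pumping M Reach (λ ρ x → ρ ◆ (_ , x ◅ ε)) N stable τ X₀ t₀ len
        (In V) (λ r → Vec.lookup V r Boolₚ.≟ true) closed onto public
      open Iteration (X₀ ∷ t₀) using (iter)

      reach-iter : ∀ {σ} → Reach (q , Y ∷ σ) → ∀ n {r} → In V r → Reach (r , iter n σ)
      reach-iter {σ} ρ n v = pumped n ◆ path-++ (iter n σ) (expose v)
        where
        pumped : ∀ n → Reach (q , Y ∷ iter n σ)
        pumped zero    = ρ
        pumped (suc n) = pumped n ◆ path-++ (iter n σ) around

    module Shrink {p : Q} {X : Γ} {σ : List Γ} (c : Chain p X σ)
                  (deep : suc (length codes) * window ≤ depth c) where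

      lv : ℕ → Level
      lv n = downs n (level c)

      above : ∀ n → Below n (lv n) (level c)
      above n = subst (λ m → Below n (lv m) (level c)) (+-identityʳ n) (downs-below n 0 (level c))

      δ : ℕ → List Γ
      δ n = proj₁ (above n)

      σ≡ : ∀ n → σ ≡ δ n ++ stack (lv n)
      σ≡ n = proj₁ (proj₂ (above n))

      to-top : ∀ n → Path (state (lv n) , symbol (lv n) ∷ []) (p , X ∷ δ n)
      to-top n = proj₂ (proj₂ (proj₂ (above n)))

      exposed : ℕ → Vec Bool (nQ M)
      exposed n = popSet p (X ∷ δ n)

      colour : ℕ → Colour
      colour n = state (lv n) , symbol (lv n) , exposed n

      -- Popping through `δ m` means popping through `δ n` and then through the word between the
      -- levels. Both levels expose the same set, so that word leads from this set into, and onto,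
      -- itself.
      loop-between : ∀ n m → colour n ≡ colour m → ∀ X₀ t₀ → suc (length t₀) ≤ τ →
        stack (lv n) ≡ (X₀ ∷ t₀) ++ stack (lv m) →
        Path (state (lv m) , symbol (lv m) ∷ []) (state (lv n) , symbol (lv n) ∷ X₀ ∷ t₀) →
        Loop (exposed m) (state (lv m)) (symbol (lv m)) X₀ t₀
      loop-between n m eq X₀ t₀ len σ≡′ π = record
        { len    = len
        ; around = subst₂ (λ q Y → Path (state (lv m) , symbol (lv m) ∷ []) (q , Y ∷ X₀ ∷ t₀))
                     (cong proj₁ eq) (cong (λ x → proj₁ (proj₂ x)) eq) π
        ; closed = λ {r} {r′} v ps → pops⇒popSet (subst (λ γ → Pops p (X ∷ γ) r′) (sym δ≡)
                     (pops-++⁺ (X ∷ δ n) (popSet⇒pops (subst (λ V → In V r) (sym V≡) v)) ps))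
        ; onto   = λ {r′} v →
                     let r , h , h′ = pops-++⁻ (X ∷ δ n) (subst (λ γ → Pops p (X ∷ γ) r′) δ≡ (popSet⇒pops v))
                     in r , subst (λ V → In V r) V≡ (pops⇒popSet h) , h′
        ; expose = λ {r} v →
                     let w , π′ , _ = pops⇒run (X ∷ δ m) (popSet⇒pops v)
                     in to-top m ◆ (w , π′)
        }
        where
        V≡ : exposed n ≡ exposed m
        V≡ = cong (λ x → proj₂ (proj₂ x)) eq
        δ≡ : δ m ≡ δ n ++ X₀ ∷ t₀
        δ≡ = ++-cancelʳ (stack (lv m)) (δ m) (δ n ++ X₀ ∷ t₀)
               (trans (sym (σ≡ m)) (trans (σ≡ n)
                 (trans (cong (δ n ++_) σ≡′) (sym (++-assoc (δ n) (X₀ ∷ t₀) _)))))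

      make-loop : ∀ k n → suc k ≤ window → k + n < depth c → colour n ≡ colour (suc k + n) →
        ∃₂ λ X₀ t₀ → Loop (exposed (suc k + n)) (state (lv (suc k + n))) (symbol (lv (suc k + n))) X₀ t₀
      make-loop k n k≤ lt eq = cases (downs-below (suc k) n (level c))
        where
        cases : Below (suc k) (lv (suc k + n)) (lv n) →
          ∃₂ λ X₀ t₀ → Loop (exposed (suc k + n)) (state (lv (suc k + n))) (symbol (lv (suc k + n))) X₀ t₀
        cases ([] , σ≡′ , _) = contradiction (shorter-downs k n (level c) lt)
          (≤⇒≯ (≤-reflexive (cong length σ≡′)))
        cases (X₀ ∷ t₀ , σ≡′ , t≤ , π) = X₀ , t₀ ,
          loop-between n (suc k + n) eq X₀ t₀ (≤-trans t≤ (*-monoˡ-≤ maxPush k≤)) σ≡′ π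

      record Coded (n : ℕ) (code : Code) : Set where
        constructor mkCoded
        open Σ code renaming (proj₁ to col; proj₂ to rest)
        V  = proj₂ (proj₂ col)
        X₀ = proj₁ rest
        t₀ = proj₁ (proj₂ rest)
        field
          colour≡ : colour n ≡ col
          loop    : Loop V (proj₁ col) (proj₁ (proj₂ col)) X₀ t₀
          bottoms : ∀ {r} → In V r →
                    IsBottom (In V) (X₀ ∷ t₀) (stack (lv n)) r (Vec.lookup (proj₂ (proj₂ rest)) r)

      abstract
        -- Two levels of one colour in the window give a loop, and the deeper one is coded: its tail
        -- is the one below the loop word.
        coded : ∀ w → w ≤ length codes →
          ∃ λ code → code ∈ codes × ∃ λ n → w * window ≤ n × n < suc w * window × Coded n code
        coded w w≤ = from-repeat (pigeonhole-∈ colours ≤-refl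
          (λ (i : Fin window) → colour (toℕ i + w * window)) (λ i → ∈-colours _))
          where
          from-loop : ∀ m {X₀ t₀} → w * window ≤ m → m < suc w * window →
            Loop (exposed m) (state (lv m)) (symbol (lv m)) X₀ t₀ →
            ∃ λ code → code ∈ codes × ∃ λ n → w * window ≤ n × n < suc w * window × Coded n code
          from-loop m {X₀} {t₀} m≥ m< L = from-bottoms
            (Looping.Bottom.bottoms L (stack (lv m)) (Looping.reach-iter L (chain-reach (chain (lv m)))))
            where
            from-bottoms : (∃ λ l → l ∈ bottomLabels × (∀ {r} → In (exposed m) r →
                             IsBottom (In (exposed m)) (X₀ ∷ t₀) (stack (lv m)) r (Vec.lookup l r))) →
              ∃ λ code → code ∈ codes × ∃ λ n → w * window ≤ n × n < suc w * window × Coded n code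
            from-bottoms (l , l∈ , isB) = (colour m , X₀ , t₀ , l) ,
              ∈-codes (≤-trans (n≤1+n _) (Loop.len L)) l∈ ,
              m , m≥ , m< , mkCoded refl L isB

          from-repeat : (∃₂ λ (i j : Fin window) → i Fin.< j ×
                           colour (toℕ i + w * window) ≡ colour (toℕ j + w * window)) →
            ∃ λ code → code ∈ codes × ∃ λ n → w * window ≤ n × n < suc w * window × Coded n code
          from-repeat (i , j , i<j , eq) =
            from-loop (suc k + n) (≤-trans (m≤n+m _ (toℕ j)) (≤-reflexive (sym m≡))) (≤-trans (s≤s (≤-reflexive m≡)) m<)
              (proj₂ (proj₂ (make-loop k n k≤ inside (trans eq (cong colour (sym m≡))))))
            where
            k n : ℕ
            k = toℕ j ∸ suc (toℕ i)
            n = toℕ i + w * window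
            sk+i≡j : suc k + toℕ i ≡ toℕ j
            sk+i≡j = trans (sym (+-suc k (toℕ i))) (m∸n+n≡m i<j)
            m≡ : suc k + n ≡ toℕ j + w * window
            m≡ = trans (sym (+-assoc (suc k) (toℕ i) _)) (cong (_+ w * window) sk+i≡j)
            m< : toℕ j + w * window < suc w * window
            m< = +-monoˡ-≤ (w * window) (Finₚ.toℕ<n j)
            k≤ : suc k ≤ window
            k≤ = ≤-trans (m≤m+n (suc k) (toℕ i)) (≤-trans (≤-reflexive sk+i≡j) (<⇒≤ (Finₚ.toℕ<n j)))
            inside : k + n < depth c
            inside = ≤-trans (≤-reflexive m≡) (≤-trans (<⇒≤ m<) (≤-trans (*-monoˡ-≤ window (s≤s w≤)) deep))

      Shorter : Set
      Shorter = ∃ λ s → Reach s × length (proj₂ s) < suc (length σ) × (p , X ∷ σ) ≈ s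

      -- `δ n` is moved onto the deeper tail. Equal states and symbols keep the result reachable,
      -- and equal bottoms keep it equivalent.
      excise : ∀ {n m code} → Coded n code → Coded m code → n < m → m ≤ depth c → Shorter
      excise {n} {m} {_ , _ , _ , l} (mkCoded refl L isBₙ) (mkCoded eqₘ _ isBₘ) n<m m≤ =
        (p , X ∷ δ n ++ stack (lv m)) ,
        reachₘ ◆ path-++ (stack (lv m)) (to-top n) ,
        s≤s (≤-trans (≤-reflexive (trans (cong suc (length-++ (δ n))) (sym (+-suc (length (δ n)) _))))
          (≤-trans (+-monoʳ-≤ (length (δ n)) shorter)
            (≤-reflexive (trans (sym (length-++ (δ n))) (cong length (sym (σ≡ n))))))) ,
        subst (λ ρ → (p , X ∷ ρ) ≈ (p , X ∷ δ n ++ stack (lv m))) (sym (σ≡ n))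
          (cong-≈ (X ∷ δ n) λ ps → Looping.bottoms-determine L
            (Looping.reach-iter L (chain-reach (chain (lv n)))) (Looping.reach-iter L reachₘ)
            l isBₙ isBₘ (pops⇒popSet ps))
        where
        reachₘ : Reach (state (lv n) , symbol (lv n) ∷ stack (lv m))
        reachₘ = subst₂ (λ q Y → Reach (q , Y ∷ stack (lv m)))
          (cong proj₁ eqₘ) (cong (λ x → proj₁ (proj₂ x)) eqₘ) (chain-reach (chain (lv m)))
        shorter : length (stack (lv m)) < length (stack (lv n))
        shorter = subst (λ m → length (stack (lv m)) < length (stack (lv n)))
          (trans (sym (+-suc k n)) k+sn≡m)
          (shorter-downs k n (level c) (≤-trans (≤-reflexive (trans (sym (+-suc k n)) k+sn≡m)) m≤))
          where
          k = m ∸ suc n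
          k+sn≡m : k + suc n ≡ m
          k+sn≡m = m∸n+n≡m n<m

      shrink : Shorter
      shrink with label-recurs codes window Coded coded
      ... | _ , n , m , n<m , m< , codedₙ , codedₘ = excise codedₙ codedₘ n<m (≤-trans (<⇒≤ m<) deep)

    -- Each stair adds at most `maxPush` symbols, so a stack above `heightBound` has enough stairs
    -- for one window more than there are codes.
    shrink : ∀ {s} → Reach s → heightBound < length (proj₂ s) →
             ∃ λ s′ → Reach s′ × length (proj₂ s′) < length (proj₂ s) × s ≈ s′
    shrink {p , X ∷ σ} ρ (s≤s tall) = Shrink.shrink c
      (*-cancelʳ-≤ _ _ maxPush (+-cancelˡ-≤ (length α₀) _ _
        (≤-trans (≤-trans (n≤1+n _) tall) (length≤depth c))))
      where c = top ρ

    short-representative : ∀ {s} → Reach s →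
      ∃ λ s′ → Reach s′ × length (proj₂ s′) ≤ heightBound × s ≈ s′
    short-representative {s} ρ = <-rec
      (λ n → ∀ {s} → length (proj₂ s) ≡ n → Reach s →
             ∃ λ s′ → Reach s′ × length (proj₂ s′) ≤ heightBound × s ≈ s′)
      go (length (proj₂ s)) refl ρ
      where
      go : ∀ n → (∀ {m} → m < n → ∀ {s} → length (proj₂ s) ≡ m → Reach s →
             ∃ λ s′ → Reach s′ × length (proj₂ s′) ≤ heightBound × s ≈ s′) →
           ∀ {s} → length (proj₂ s) ≡ n → Reach s →
             ∃ λ s′ → Reach s′ × length (proj₂ s′) ≤ heightBound × s ≈ s′
      go n ih {s} refl ρ with length (proj₂ s) ≤? heightBound
      ... | yes le = s , ρ , le , ≈-refl
      ... | no ¬le =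
        let s₁ , ρ₁ , lt , h = shrink ρ (≰⇒> ¬le)
            s₂ , ρ₂ , le , h′ = ih lt refl ρ₁
        in s₂ , ρ₂ , le , ≈-trans h h′

-- Finite certificates of regularity

module Certificates (M : PDA) (p₀ : Fin (nQ M)) (α₀ : List (Fin (nΓ M))) (K : ℕ) where

  open FiniteStacks M

  -- The pair (r , j) says that r σ is equivalent to state j, for the stack σ at hand.
  StackType : Set
  StackType = List (Q × Fin K)

  pairs : List (Q × Fin K)
  pairs = cartesianProduct (allFin _) (allFin K)

  -- An entry `((p , X) , φ , i)` claims the value `i` for `p X σ` whenever `σ` has type `φ`.
  Entry Trans : Set
  Entry = (Q × Γ) × StackType × Fin K
  Trans = Fin K × Act × Fin K

  entries : List Entry
  entries = cartesianProduct (cartesianProduct (allFin _) (allFin _)) (cartesianProduct (sublists pairs) (allFin K))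

  transitions : List Trans
  transitions = cartesianProduct (allFin K) (cartesianProduct (allFin _) (allFin K))

  _≟pair_ : DecidableEquality (Q × Fin K)
  _≟pair_ = Productₚ.≡-dec Finₚ._≟_ Finₚ._≟_

  _≟entry_ : DecidableEquality Entry
  _≟entry_ = Productₚ.≡-dec (Productₚ.≡-dec Finₚ._≟_ Finₚ._≟_)
               (Productₚ.≡-dec (Listₚ.≡-dec _≟pair_) Finₚ._≟_)

  _≟trans_ : DecidableEquality Trans
  _≟trans_ = Productₚ.≡-dec Finₚ._≟_ (Productₚ.≡-dec Finₚ._≟_ Finₚ._≟_)

  open DecMembership _≟pair_ using () renaming (_∈?_ to _∈pair?_)
  open DecMembership _≟entry_ using () renaming (_∈?_ to _∈entry?_)
  open DecMembership _≟trans_ using () renaming (_∈?_ to _∈trans?_)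

  module _ (W : List Entry) where

    -- W derives the value j for p γ σ from the type φ of the stack σ.
    Value : Q → List Γ → StackType → Fin K → Set
    Value p []      φ j = (p , j) ∈ φ
    Value p (X ∷ γ) φ j = Any (λ ψ → All (λ (r , i) → Value r γ φ i) ψ × ((p , X) , ψ , j) ∈ W) (sublists pairs)

    value? : ∀ p γ φ j → Dec (Value p γ φ j)
    value? p []      φ j = (p , j) ∈pair? φ
    value? p (X ∷ γ) φ j =
      any? (λ ψ → all? (λ (r , i) → value? r γ φ i) ψ ×-dec (((p , X) , ψ , j) ∈entry? W)) (sublists pairs)

    value-++ : ∀ {p} γ {σ φ χ j} → Value p γ φ j → All (λ (r , i) → Value r σ χ i) φ → Value p (γ ++ σ) χ j
    value-++ []      h φσ = All.lookup φσ h
    value-++ (X ∷ γ) h φσ = Any.map (λ (all , w∈) → All.map (λ h′ → value-++ γ h′ φσ) all , w∈) h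

    module _ (δ : List Trans) where

      Fires : Q → Γ → StackType → Fin K → Rule (nQ M) (nΓ M) (nA M) → Set
      Fires p X φ i ρ = Rule.src ρ ≡ p × Rule.top ρ ≡ X →
        ∃ λ j → (i , Rule.act ρ , j) ∈ δ × Value (Rule.tgt ρ) (Rule.push ρ) φ j

      Fired : Q → Γ → StackType → Fin K → Trans → Set
      Fired p X φ i (i′ , a , j) = i′ ≡ i → Any (λ ρ → (Rule.src ρ ≡ p × Rule.top ρ ≡ X × Rule.act ρ ≡ a)
                                                     × Value (Rule.tgt ρ) (Rule.push ρ) φ j) (Δ M)

      -- The two bisimulation conditions, checked against the type alone and hence valid for every
      -- tail of that type.
      Consistent : Entry → Set
      Consistent ((p , X) , φ , i) = All (Fires p X φ i) (Δ M) × All (Fired p X φ i) δ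

      consistent? : ∀ e → Dec (Consistent e)
      consistent? ((p , X) , φ , i) =
        all? (λ ρ → ((Rule.src ρ Finₚ.≟ p) ×-dec (Rule.top ρ Finₚ.≟ X)) →-dec
                Finₚ.any? λ j → ((i , Rule.act ρ , j) ∈trans? δ) ×-dec value? _ _ φ j) (Δ M) ×-dec
        all? (λ (i′ , a , j) → (i′ Finₚ.≟ i) →-dec
                any? (λ ρ → ((Rule.src ρ Finₚ.≟ p) ×-dec ((Rule.top ρ Finₚ.≟ X) ×-dec (Rule.act ρ Finₚ.≟ a)))
                              ×-dec value? _ _ φ j) (Δ M)) δ

      -- `φ` is the type of the empty stack, which cannot move; its states must therefore be dead.
      Certificate : StackType → Set
      Certificate φ = All Consistent W
                    × All (λ (r , j) → All (λ (i , a , j′) → ¬ i ≡ j) δ) φ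
                    × ∃ λ j → Value p₀ α₀ φ j

      certificate? : ∀ φ → Dec (Certificate φ)
      certificate? φ = all? consistent? W ×-dec
        (all? (λ (r , j) → all? (λ (i , a , j′) → ¬? (i Finₚ.≟ j)) δ) φ ×-dec
        Finₚ.any? λ j → value? p₀ α₀ φ j)

      sound : ∀ {φ} → Certificate φ → Regular M p₀ α₀
      sound {φ} (consistent , dead , j₀ , init) = F , j₀ , B , bisimulation , init
        where
        L = PDA-LTS M
        F : FiniteLTS (nA M)
        F = K , λ i a j → does ((i , a , j) ∈trans? δ)
        edge : ∀ {x} → does (x ∈trans? δ) ≡ true → x ∈ δ
        edge {x} eq with x ∈trans? δ | eq
        ... | yes x∈ | _ = x∈
        edge⁻¹ : ∀ {x} → x ∈ δ → does (x ∈trans? δ) ≡ true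
        edge⁻¹ {x} x∈ with x ∈trans? δ
        ... | yes _  = refl
        ... | no x∉ = contradiction x∈ x∉
        B : Config M ⊎ Fin K → Config M ⊎ Fin K → Set
        B (inj₁ (p , fin σ)) (inj₂ i) = Value p σ φ i
        B _                  _        = ⊥
        bisimulation : IsBisimulation (L ⊎ᴸ finiteLTS F) B
        bisimulation (inj₁ (p , fin [])) (inj₂ i) h =
          (λ { a (inj₁ _) (pstep _ ()) }) ,
          (λ { a (inj₂ j) x → contradiction refl (All.lookup (All.lookup dead h) (edge x)) })
        bisimulation (inj₁ (p , fin (X ∷ σ))) (inj₂ i) h with find h
        ... | ψ , _ , ψσ , w∈ with All.lookup consistent w∈
        ... | fires , fired =
          (λ { a (inj₁ _) (pstep {α = α} r∈ pop-fin) →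
                 let j , d , val = All.lookup fires r∈ (refl , refl)
                 in inj₂ j , edge⁻¹ d , value-++ α val ψσ }) ,
          (λ { a (inj₂ j) x → back a j (find (All.lookup fired (edge x) refl)) })
          where
          back : ∀ a j → (∃ λ ρ → ρ ∈ Δ M × (Rule.src ρ ≡ p × Rule.top ρ ≡ X × Rule.act ρ ≡ a)
                                            × Value (Rule.tgt ρ) (Rule.push ρ) ψ j) →
            Σ (Config M ⊎ Fin K) λ s → UnionStep L (finiteLTS F) (inj₁ (p , fin (X ∷ σ))) a s × B s (inj₂ j)
          back a j (rule _ _ _ q α , r∈ , (refl , refl , refl) , val) =
            inj₁ (q , fin (α ++ σ)) , pstep r∈ pop-fin , value-++ α val ψσ

  Certified : Set
  Certified = Any (λ W → Any (λ δ → Any (Certificate W δ) (sublists pairs)) (sublists transitions)) (sublists entries)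

  certified? : Dec Certified
  certified? = any? (λ W → any? (λ δ → any? (certificate? W δ) (sublists pairs)) (sublists transitions)) (sublists entries)

  certified⇒regular : Certified → Regular M p₀ α₀
  certified⇒regular c =
    let W , _ , c₁ = find c
        δ , _ , c₂ = find c₁
        φ , _ , c₃ = find c₂
    in sound W δ c₃

-- Regular configurations have certificates

module Decision (M : PDA) (p₀ : Fin (nQ M)) (α₀ : List (Fin (nΓ M))) where

  open FiniteStacks M
  open Shrinking M p₀ α₀
  open Bounds M 0 using (confsUpTo; ∈-confsUpTo)

  reps : List Conf
  reps = confsUpTo heightBound

  K : ℕ
  K = length reps

  open Certificates M p₀ α₀ K

  module Completeness (N : ℕ) (stable : ∀ {s t} → Reach s → Reach t → s ~[ N ] t → s ≈ t) where
    open Stable M Reach (λ ρ x → ρ ◆ (_ , x ◅ ε)) N stable using (match)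

    rep : Fin K → Conf
    rep = lookup reps

    -- Reachability is kept on both sides because `match` works among reachable configurations.
    Is : Conf → Fin K → Set
    Is s j = Reach s × Reach (rep j) × s ≈ rep j

    representative : ∀ {s} → Reach s → ∃ (Is s)
    representative ρ =
      let s′ , ρ′ , le , h = short-representative N stable ρ
          s′∈ = ∈-confsUpTo heightBound s′ le
          eq  = lookup-index s′∈
      in Any.index s′∈ , ρ , subst Reach eq ρ′ , subst (_ ≈_) eq h

    Edge : Trans → Set
    Edge (i , a , j) = Reach (rep i) × ∃ λ d → Step (rep i) a d × Is d j

    record HasType (σ : List Γ) (φ : StackType) : Set where
      field
        φ∈         : φ ∈ sublists pairs
        φ-sound    : ∀ {x} → x ∈ φ → Is (proj₁ x , σ) (proj₂ x)
        φ-complete : ∀ {r j} → Is (r , σ) j → (r , j) ∈ φ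
    open HasType

    Typed : Entry → Set
    Typed ((p , X) , φ , i) = ∃ λ σ → HasType σ φ × Is (p , X ∷ σ) i

    ¬¬-type : ∀ σ → ¬ ¬ (∃ (HasType σ))
    ¬¬-type σ k = ¬¬-comprehension (λ (r , j) → Is (r , σ) j) pairs λ (φ , φ∈ , snd , cmp) →
      k (φ , record { φ∈ = φ∈ ; φ-sound = snd
                    ; φ-complete = λ is → cmp (∈-cartesianProduct⁺ (∈-allFin _) (∈-allFin _)) is })

    module _ {W : List Entry} {δ : List Trans}
      (W-sound : ∀ {e} → e ∈ W → Typed e) (W-complete : ∀ {e} → e ∈ entries → Typed e → e ∈ W)
      (δ-sound : ∀ {x} → x ∈ δ → Edge x) (δ-complete : ∀ {x} → x ∈ transitions → Edge x → x ∈ δ) where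

      -- The type of the stack below exists only up to double negation, which the decidability of
      -- `Value` removes.
      evaluates : ∀ {q} α {σ φ j} → HasType σ φ → Is (q , α ++ σ) j → Value W q α φ j
      evaluates []      ty is = φ-complete ty is
      evaluates {q} (X ∷ α) {σ} {φ} {j} ty is =
        decidable-stable (value? W q (X ∷ α) φ j) λ ¬val → ¬¬-type (α ++ σ) λ (ψ , tyψ) →
          ¬val (lose (φ∈ tyψ)
            ( All.tabulate (λ x∈ → evaluates α ty (φ-sound tyψ x∈))
            , W-complete (∈-cartesianProduct⁺ (∈-cartesianProduct⁺ (∈-allFin q) (∈-allFin X))
                            (∈-cartesianProduct⁺ (φ∈ tyψ) (∈-allFin j))) (α ++ σ , tyψ , is)))

      -- The conditions mention only `φ`, yet one witnessing tail `σ` settles them: its type records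
      -- exactly the classes of the configurations `r σ`.
      typed⇒consistent : ∀ e → Typed e → Consistent W δ e
      typed⇒consistent ((p , X) , φ , i) (σ , ty , ρ , ρᵢ , h) =
        All.tabulate (λ { {rule _ _ a q α} r∈ (refl , refl) →
          let x = q , α , r∈ , refl
              d , y , h′ = match ρ ρᵢ h x
              j , is@(_ , ρⱼ , h″) = representative (ρ ◆ (_ , x ◅ ε))
          in j , δ-complete (∈-cartesianProduct⁺ (∈-allFin i) (∈-cartesianProduct⁺ (∈-allFin a) (∈-allFin j)))
                   (ρᵢ , d , y , ρᵢ ◆ (_ , y ◅ ε) , ρⱼ , ≈-trans (≈-sym h′) h″) ,
             evaluates α ty is }) ,
        All.tabulate (λ { {_ , a , j} x∈ refl → fired a j (δ-sound x∈) })
        where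
        fired : ∀ a j → Edge (i , a , j) → Any (λ ρ → (Rule.src ρ ≡ p × Rule.top ρ ≡ X × Rule.act ρ ≡ a)
                                                 × Value W (Rule.tgt ρ) (Rule.push ρ) φ j) (Δ M)
        fired a j (_ , d , y , _ , ρⱼ , h′) with match ρᵢ ρ (≈-sym h) y
        ... | _ , x@(q , α , r∈ , refl) , h″ = lose r∈
              ((refl , refl , refl) , evaluates α ty (ρ ◆ (_ , x ◅ ε) , ρⱼ , ≈-trans (≈-sym h″) h′))

      certificate : ∀ {φ} → HasType [] φ → Certificate W δ φ
      certificate ty =
        All.tabulate (λ {e} e∈ → typed⇒consistent e (W-sound e∈)) ,
        All.tabulate (λ x∈ → All.tabulate λ { {_ , _ , _} e∈ refl → dead (φ-sound ty x∈) (δ-sound e∈) }) ,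
        let j , is = representative (_ , ε)
        in j , evaluates α₀ ty (subst (λ α → Is (p₀ , α) j) (sym (++-identityʳ α₀)) is)
        where
        dead : ∀ {r i a j} → Is (r , []) i → ¬ Edge (i , a , j)
        dead (ρ , ρᵢ , h) (_ , _ , y , _) = proj₁ (proj₂ (match ρᵢ ρ (≈-sym h) y))

    ¬¬-certified : ¬ ¬ Certified
    ¬¬-certified k =
      ¬¬-comprehension Typed entries λ (W , W∈ , Ws , Wc) →
      ¬¬-comprehension Edge transitions λ (δ , δ∈ , δs , δc) →
      ¬¬-type [] λ (φ , ty) →
      k (lose W∈ (lose δ∈ (lose (φ∈ ty) (certificate Ws Wc δs δc ty))))

  -- A uniform level of distinction from a finite system

  module _ (reg : Regular M p₀ α₀) where

    private
      n = proj₁ (proj₁ reg)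
      LU = PDA-LTS M ⊎ᴸ finiteLTS (proj₁ reg)
      B = proj₁ (proj₂ (proj₂ reg))
      isB = proj₁ (proj₂ (proj₂ (proj₂ reg)))

    Matches : Conf → Fin n → Set
    Matches (p , σ) f = B (inj₁ (p , fin σ)) (inj₂ f)

    forth : ∀ {s f a s′} → Matches s f → Step s a s′ →
            ∃ λ f′ → UnionStep (PDA-LTS M) (finiteLTS (proj₁ reg)) (inj₂ f) a (inj₂ f′) × Matches s′ f′
    forth {p , X ∷ σ} b (q , α , r∈ , refl)
      with proj₁ (isB _ _ b) _ (inj₁ (q , fin (α ++ σ))) (pstep r∈ pop-fin)
    ... | inj₂ f′ , x , b′ = f′ , x , b′

    back : ∀ {s f a f′} → Matches s f →
           UnionStep (PDA-LTS M) (finiteLTS (proj₁ reg)) (inj₂ f) a (inj₂ f′) →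
           ∃ λ s′ → Step s a s′ × Matches s′ f′
    back {p , []} {f} {a} {f′} b x with proj₂ (isB (inj₁ (p , fin [])) (inj₂ f) b) a (inj₂ f′) x
    ... | inj₁ _ , pstep _ () , _
    back {p , X ∷ σ} {f} {a} {f′} b x with proj₂ (isB (inj₁ (p , fin (X ∷ σ))) (inj₂ f) b) a (inj₂ f′) x
    ... | inj₁ _ , pstep r∈ pop-fin , b′ = _ , (_ , _ , r∈ , refl) , b′

    same-match : ∀ k {s t f} → Matches s f → Matches t f → s ~[ k ] t
    same-match zero    _ _  = _
    same-match (suc k) b b′ =
      (λ x → let f′ , y , c = forth b x ; t′ , z , c′ = back b′ y in t′ , z , same-match k c c′) ,
      (λ x → let f′ , y , c = forth b′ x ; s′ , z , c′ = back b y in s′ , z , same-match k c′ c)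

    reach-matches : ∀ {s t f w} → Matches s f → Run s w t → ∃ (Matches t)
    reach-matches b ε       = _ , b
    reach-matches b (x ◅ π) = reach-matches (proj₂ (proj₂ (forth b x))) π

    StableAt : Fin n → Fin n → ℕ → Set
    StableAt f g k = ∀ {s t} → Matches s f → Matches t g → s ~[ k ] t → s ≈ t

    -- Either no configurations matched with f and g are ever distinguished, or a level
    -- distinguishing one such pair distinguishes all of them.
    ¬¬-stable : ∀ f g → ¬ ¬ (∃ (StableAt f g))
    ¬¬-stable f g none = none (0 , λ {s} {t} b c _ j → decidable-stable (~-dec j s t) λ s≁t →
      none (j , λ b′ c′ h → ⊥-elim (s≁t
        (~-trans j (same-match j b b′) (~-trans j h (same-match j c′ c))))))

    -- Every reachable configuration is matched with one of `n` states, so the maximum of the levels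
    -- over pairs of states is uniform.
    ¬¬-level : ¬ ¬ (∃ λ N → ∀ {s t} → Reach s → Reach t → s ~[ N ] t → s ≈ t)
    ¬¬-level none = ¬¬-Fin n (λ f → ¬¬-Fin n (¬¬-stable f)) λ at →
      let bound = λ f → Fin-bounded n (λ g → proj₁ (at f g))
          N , N≥ = Fin-bounded n (λ f → proj₁ (bound f))
          b₀ = proj₂ (proj₂ (proj₂ (proj₂ reg)))
      in none (N , λ (_ , π) (_ , ρ) h →
           let f , b = reach-matches b₀ π
               g , c = reach-matches b₀ ρ
           in proj₂ (at f g) b c (~-mono (≤-trans (proj₂ (bound f) g) (N≥ f)) h))

  -- The level is known only under double negation; since `Certified` is a decidable search through
  -- a finite space, this is enough.
  regular⇒certified : Regular M p₀ α₀ → Certified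
  regular⇒certified reg = decidable-stable certified? λ ¬c →
    ¬¬-level reg λ (N , stable) → Completeness.¬¬-certified N stable ¬c

theorem2 : (M : PDA) (p₀ : Fin (nQ M)) (α₀ : List (Fin (nΓ M))) →
           Dec (Regular M p₀ α₀)
theorem2 M p₀ α₀ = map′ certified⇒regular regular⇒certified certified?
  where
  open Decision M p₀ α₀
  open Certificates M p₀ α₀ K
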